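{- Let $G=(V,E)$ be a graph that may have self-loops but has no parallel edges, let $\mathcal{T}$ be a set of triangles in $G$, and let $A_1, A_2\subseteq E$ be $\mathcal{T}$-free 2-matchings in $G$. Then there exists a partition $\mathcal{P}$ of $A_1 \bigtriangleup A_2$ into alternating trails with respect to $(A_1, A_2)$ such that $A_i \bigtriangleup P$ is a $\mathcal{T}$-free 2-matching for $i=1,2$ and for every $P\in\mathcal{P}$.
   Context: For $F\subseteq E$ and $v\in V$, $d_F(v)$ is the number of edges of $F$ incident to $v$, where a self-loop at $v$ is counted twice. A 2-matching is an edge set $M\subseteq E$ with $d_M(v)\le 2$ for all $v\in V$. A triangle is an edge set forming a cycle of length $3$ (on three distinct vertices). Given a set $\mathcal{T}$ of triangles, an edge set $F$ is $\mathcal{T}$-free if it contains no triangle $T\in\mathcal{T}$ as a subset. A trail is a sequence of distinct consecutive edges $u_1u_2, u_2u_3, \dots, u_ku_{k+1}$ (the vertices $u_j$ need not be distinct), identified with its edge set when convenient. For 2-matchings $A_1, A_2$, a trail is alternating with respect to $(A_1,A_2)$ if it traverses edges of $A_1\setminus A_2$ and $A_2\setminus A_1$ alternately. $\bigtriangleup$ denotes symmetric difference. -}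

module Defs where

open import Data.Nat using (ℕ; zero; suc; _+_; _≤_)
open import Data.Fin using (Fin; zero; suc; _≟_)
open import Data.Bool using (Bool; true; false; if_then_else_; _xor_)
open import Data.List using (List; []; _∷_; concat)
open import Data.Bool.ListAction using (any)
open import Data.List.Relation.Unary.All using (All)
open import Data.List.Relation.Unary.Linked using (Linked)
open import Data.List.Relation.Unary.Unique.Propositional using (Unique)
open import Data.List.Membership.Propositional using (_∈_)
open import Data.Product using (Σ; ∃; _×_; _,_)
open import Data.Sum using (_⊎_)
open import Relation.Nullary using (¬_; does)
open import Relation.Binary.PropositionalEquality using (_≡_; _≢_)
open import Function.Bundles using (_⇔_)

∑ : ∀ {m} → (Fin m → ℕ) → ℕ
∑ {zero} f = 0
∑ {suc m} f = f zero + ∑ (λ i → f (suc i))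

SameEnds : ∀ {n m} → (Fin m → Fin n) → (Fin m → Fin n) → Fin m → Fin m → Set
SameEnds s t e f = (s e ≡ s f × t e ≡ t f) ⊎ (s e ≡ t f × t e ≡ s f)

-- A finite graph on vertex set Fin n with edge set Fin m.  Edge e joins
-- src e and tgt e (unordered); src e ≡ tgt e is a self-loop.  No parallel edges.
record Graph (n m : ℕ) : Set where
  field
    src tgt    : Fin m → Fin n
    noParallel : ∀ e f → SameEnds src tgt e f → e ≡ f
open Graph public

EdgeSet : ℕ → Set
EdgeSet m = Fin m → Bool

_△_ : ∀ {m} → EdgeSet m → EdgeSet m → EdgeSet m
(A △ B) e = A e xor B e

_⊆ₑ_ : ∀ {m} → EdgeSet m → EdgeSet m → Set
A ⊆ₑ B = ∀ e → A e ≡ true → B e ≡ true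

toSet : ∀ {m} → List (Fin m) → EdgeSet m
toSet P e = any (λ f → does (e ≟ f)) P

-- number of endpoints of e equal to v (a loop at v counts twice)
inc : ∀ {n m} → Graph n m → Fin n → Fin m → ℕ
inc G v e = (if does (src G e ≟ v) then 1 else 0) + (if does (tgt G e ≟ v) then 1 else 0)

deg : ∀ {n m} → Graph n m → EdgeSet m → Fin n → ℕ
deg G F v = ∑ (λ e → if F e then inc G v e else 0)

IsTwoMatching : ∀ {n m} → Graph n m → EdgeSet m → Set
IsTwoMatching G M = ∀ v → deg G M v ≤ 2

Joins : ∀ {n m} → Graph n m → Fin m → Fin n → Fin n → Set
Joins G e u w = (src G e ≡ u × tgt G e ≡ w) ⊎ (src G e ≡ w × tgt G e ≡ u)

IsTriangle : ∀ {n m} → Graph n m → EdgeSet m → Set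
IsTriangle {n} {m} G T =
  Σ (Fin m) λ e₁ → Σ (Fin m) λ e₂ → Σ (Fin m) λ e₃ →
  Σ (Fin n) λ a → Σ (Fin n) λ b → Σ (Fin n) λ c →
    (a ≢ b × b ≢ c × a ≢ c)
  × Joins G e₁ a b × Joins G e₂ b c × Joins G e₃ c a
  × (∀ x → (T x ≡ true) ⇔ (x ≡ e₁ ⊎ x ≡ e₂ ⊎ x ≡ e₃))

TFree : ∀ {m} → (EdgeSet m → Set) → EdgeSet m → Set
TFree 𝒯 F = ∀ T → 𝒯 T → ¬ (T ⊆ₑ F)

data WalkFrom {n m} (G : Graph n m) : Fin n → List (Fin m) → Set where
  nil  : ∀ u → WalkFrom G u []
  cons : ∀ {u w es} e → Joins G e u w → WalkFrom G w es → WalkFrom G u (e ∷ es)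

IsTrail : ∀ {n m} → Graph n m → List (Fin m) → Set
IsTrail G es = (es ≢ []) × Unique es × ∃ λ u → WalkFrom G u es

OnlyIn : ∀ {m} → EdgeSet m → EdgeSet m → Fin m → Set
OnlyIn A B e = A e ≡ true × B e ≡ false

IsAlternating : ∀ {m} → EdgeSet m → EdgeSet m → List (Fin m) → Set
IsAlternating A₁ A₂ es =
  All (λ e → OnlyIn A₁ A₂ e ⊎ OnlyIn A₂ A₁ e) es
  × Linked (λ e f → (OnlyIn A₁ A₂ e × OnlyIn A₂ A₁ f) ⊎ (OnlyIn A₂ A₁ e × OnlyIn A₁ A₂ f)) es

IsAltTrailPartition : ∀ {n m} → Graph n m → EdgeSet m → EdgeSet m → EdgeSet m → List (List (Fin m)) → Set
IsAltTrailPartition G A₁ A₂ S 𝒫 =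
  All (λ P → IsTrail G P × IsAlternating A₁ A₂ P) 𝒫
  × Unique (concat 𝒫)
  × (∀ e → e ∈ concat 𝒫 → S e ≡ true)
  × (∀ e → S e ≡ true → e ∈ concat 𝒫)

{-# OPTIONS --safe #-}
module Submission where

-- Call an edge of A₁ ∖ A₂ red and one of A₂ ∖ A₁ blue, and at every vertex match red edge
-- ends with blue ones as far as possible.  Following the matched ends decomposes A₁ △ A₂ into
-- alternating trails, and maximality of the matchings keeps all degrees at most 2.  A triangle
-- T in A₁ ∪ A₂ contained in neither Aᵢ has a red and a blue edge, and T ⊆ Aᵢ △ P is impossible
-- for all P as soon as some red and some blue edge of T lie on a common trail ("T is satisfied").
--
-- It remains to choose the matchings so that all these mixed triangles are satisfied.  We
-- prescribe matched pairs at more and more vertices, keeping the invariant that every mixed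
-- triangle through a prescribed vertex is satisfied by every maximal completion.  Let T be a
-- mixed triangle without prescribed vertices.
--   * If T has a common edge xy, prescribe the red-blue pair at its third vertex.
--   * Otherwise T has edges px, py of one colour and xy of the other.  Prescribing px–xy at x and
--     xy–yp at y turns T into a loop at p which meets every other edge at p.  This works unless
--     there is a mixed triangle xyq with p and q not adjacent.
--   * If qx and qy have the colour of px, prescribe instead a path pxyq or pyxq, together with a
--     pair at p or q when both paths conflict with other triangles.
--   * If only qx does, replace T by xyq and then by the next triangle around x.  Either one of
--     them can be turned into a loop, or a case above applies, or four triangles close up to a
--     wheel around x, and then two opposite ones are turned into loops at once.

open import Defs
open import Data.Nat using (ℕ; zero; suc; _+_; _≤_; z≤n; s≤s)
open import Data.Nat.Properties using (≤-trans; ≤-reflexive; m≤m+n; m≤n+m; +-suc; +-monoʳ-≤; <-irrefl)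
open import Data.Bool using (Bool; true; false; not; if_then_else_)
open import Data.Bool.Properties using (not-involutive; not-¬) renaming (_≟_ to _≟ᵇ_)
open import Data.Empty using (⊥; ⊥-elim)
open import Data.Fin using (Fin; zero; suc; _≟_)
open import Data.Fin.Properties using (any?)
open import Data.List using (List; []; _∷_; _++_; map; length; allFin; concat; concatMap; tabulate; cartesianProduct; filter)
open import Data.List.Membership.DecPropositional using () renaming (_∈?_ to member?)
open import Data.List.Membership.Propositional using (_∈_; _∉_; find; lose)
open import Data.List.Membership.Propositional.Properties using (∈-++⁻; ∈-++⁺ˡ; ∈-++⁺ʳ; ∈-∃++; ∈-allFin; ∈-concat⁺′; ∈-concat⁻′; ∈-tabulate⁺; ∈-tabulate⁻; ∈-cartesianProduct⁺; ∈-map⁺; ∈-filter⁺; ∈-filter⁻)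
open import Data.List.Properties using (map-++; length-++; length-map; length-tabulate; ++-assoc)
open import Data.List.Relation.Binary.Permutation.Propositional using (_↭_; prep; swap; ↭-sym; ↭-reflexive; ↭⇒↭ₛ)
open import Data.List.Relation.Binary.Permutation.Propositional.Properties using (shift; ↭-length; ∈-resp-↭; ++⁺; ++⁺ˡ; ++⁺ʳ; ++-comm; shifts)
open import Data.List.Relation.Binary.Permutation.Setoid.Properties using (Unique-resp-↭)
open import Data.List.Relation.Unary.All as All using (All; []; _∷_)
import Data.List.Relation.Unary.All.Properties as AllP
open import Data.List.Relation.Unary.AllPairs using ([]; _∷_)
import Data.List.Relation.Unary.AllPairs.Properties as AllPairs
open import Data.List.Relation.Unary.Any as Any using (here; there)
open import Data.List.Relation.Unary.Linked using ([-]; _∷_)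
open import Data.List.Relation.Unary.Unique.Propositional using (Unique)
import Data.List.Relation.Unary.Unique.Propositional.Properties as Unique
open import Data.Maybe using (Maybe; just; nothing)
open import Data.Maybe.Properties as Maybe using (just-injective)
open import Data.Product using (Σ; ∃; ∃₂; _×_; _,_; proj₁; proj₂)
open import Data.Product.Properties using (≡-dec)
open import Data.Sum using (_⊎_; inj₁; inj₂; [_,_]′)
open import Function using (_∘_; case_of_)
open import Function.Bundles using (Equivalence)
open import Relation.Nullary using (¬_; Dec; yes; no; ¬?; does)
open import Relation.Nullary.Decidable using (_×-dec_; _⊎-dec_; map′)
open import Relation.Binary.PropositionalEquality using (_≡_; _≢_; refl; sym; trans; cong; cong₂; subst; ≢-sym; setoid)
open _↭_ using (refl) renaming (trans to ↭trans)

-- Counting in duplicate-free lists.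

extract : ∀ {A : Set} {x : A} {xs} → x ∈ xs → ∃ λ ys → xs ↭ x ∷ ys
extract {x = x} i with us , vs , refl ← ∈-∃++ i = us ++ vs , shift x us vs

-- Induction on `xs`: the partner of the head is removed from `ys`, and injectivity keeps it from
-- being wanted again. A relation in place of a function allows partners that are chosen by cases.
length-inj : ∀ {A B : Set} (R : A → B → Set) (xs : List A) (ys : List B) → Unique xs
  → (∀ {x} → x ∈ xs → ∃ λ y → y ∈ ys × R x y)
  → (∀ {x x′ y} → x ∈ xs → x′ ∈ xs → R x y → R x′ y → x ≡ x′)
  → length xs ≤ length ys
length-inj R []       ys _           _   _   = z≤n
length-inj R (x ∷ xs) ys (x∉xs ∷ us) img inj
  with y , y∈ys , Rxy ← img (here refl)
  with ys′ , ys↭ ← extract y∈ys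
  rewrite ↭-length ys↭ = s≤s (length-inj R xs ys′ us img′ λ i j → inj (there i) (there j))
  where
    img′ : ∀ {x′} → x′ ∈ xs → ∃ λ y′ → y′ ∈ ys′ × R x′ y′
    img′ i with y′ , y′∈ys , Rx′y′ ← img (there i) with ∈-resp-↭ ys↭ y′∈ys
    ... | here refl = ⊥-elim (All.lookup x∉xs i (inj (here refl) (there i) Rxy Rx′y′))
    ... | there j   = y′ , j , Rx′y′

unique-length≤ : ∀ {n} (xs : List (Fin n)) → Unique xs → length xs ≤ n
unique-length≤ {n} xs us = subst (length xs ≤_) (length-tabulate {n = n} (λ i → i))
  (length-inj _≡_ xs (allFin n) us (λ {x} _ → x , ∈-allFin x , refl) (λ _ _ p q → trans p (sym q)))

-- Colours of edges.

data Kind : Set where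
  none both : Kind
  only      : Bool → Kind

_≟ᵏ_ : (k l : Kind) → Dec (k ≡ l)
none ≟ᵏ none = yes refl
both ≟ᵏ both = yes refl
(only a) ≟ᵏ (only b) = map′ (cong only) (λ { refl → refl }) (a ≟ᵇ b)
none ≟ᵏ both = no λ ()
none ≟ᵏ (only _) = no λ ()
both ≟ᵏ none = no λ ()
both ≟ᵏ (only _) = no λ ()
(only _) ≟ᵏ none = no λ ()
(only _) ≟ᵏ both = no λ ()

data Opp : Bool → Bool → Set where
  red-blue : Opp true false
  blue-red : Opp false true

Opp-sym : ∀ {c d} → Opp c d → Opp d c
Opp-sym red-blue = blue-red
Opp-sym blue-red = red-blue

-- st u v records which of A₁ and A₂ contain the edge uv: only true stands for A₁ ∖ A₂ (red),
-- only false for A₂ ∖ A₁ (blue).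
module Prescriptions {n : ℕ} (st : Fin n → Fin n → Kind) (st-sym : ∀ u v → st u v ≡ st v u)
  (deg≤2 : ∀ {c v a b d}
    → st v a ≡ only c ⊎ st v a ≡ both
    → st v b ≡ only c ⊎ st v b ≡ both
    → st v d ≡ only c ⊎ st v d ≡ both
    → a ≢ b → a ≢ d → b ≢ d → ⊥)
  where

  V : Set
  V = Fin n

  Only : Bool → V → V → Set
  Only c u v = st u v ≡ only c

  Has : Bool → V → V → Set
  Has c u v = Only c u v ⊎ st u v ≡ both

  Adj : V → V → Set
  Adj u v = st u v ≢ none

  Only-sym : ∀ {c u v} → Only c u v → Only c v u
  Only-sym = trans (st-sym _ _)

  Adj-sym : ∀ {u v} → Adj u v → Adj v u
  Adj-sym e = e ∘ trans (st-sym _ _)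

  Only⇒Adj : ∀ {c u v} → Only c u v → Adj u v
  Only⇒Adj o e with () ← trans (sym o) e

  Only-opp : ∀ {c d u v} → Opp c d → Only c u v → Has d u v → ⊥
  Only-opp red-blue o (inj₁ e) with () ← trans (sym o) e
  Only-opp blue-red o (inj₁ e) with () ← trans (sym o) e
  Only-opp _   o (inj₂ e) with () ← trans (sym o) e

  classify : ∀ {c d u v} → Opp c d → Adj u v → Has c u v ⊎ Only d u v
  classify {u = u} {v} o e with st u v
  classify o   e | none       = ⊥-elim (e refl)
  classify o   e | both       = inj₁ (inj₂ refl)
  classify red-blue e | only true  = inj₁ (inj₁ refl)
  classify red-blue e | only false = inj₂ refl
  classify blue-red e | only true  = inj₂ refl
  classify blue-red e | only false = inj₁ (inj₁ refl)

  third : ∀ {c v a b d} → Has c v a → Has c v b → a ≢ b → Has c v d → d ≢ a → d ≡ b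
  third {b = b} {d} p q a≢b r d≢a with d ≟ b
  ... | yes e = e
  ... | no d≢b = ⊥-elim (deg≤2 p q r a≢b (≢-sym d≢a) (≢-sym d≢b))

  -- `va` and `vb` already use up the two edges of colour `c` that `v` can have.
  other-only : ∀ {c d v a b g} → Opp c d → Has c v a → Has c v b → a ≢ b
    → Adj v g → g ≢ a → g ≢ b → Only d v g
  other-only o p q a≢b e g≢a g≢b with classify o e
  ... | inj₁ h = ⊥-elim (g≢b (third p q a≢b h g≢a))
  ... | inj₂ h = h

  -- `mix` encodes that neither 2-matching contains the triangle: a triangle of the union misses the
  -- matching of one colour exactly if it has an edge of the other colour only.
  record Tri (a b c : V) : Set where
    constructor tri
    field
      a≢b : a ≢ b
      b≢c : b ≢ c
      a≢c : a ≢ c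
      ab  : Adj a b
      bc  : Adj b c
      ac  : Adj a c
      mix : ∀ k → Only k a b ⊎ Only k b c ⊎ Only k a c
  open Tri

  swap-tri : ∀ {a b c} → Tri a b c → Tri a c b
  swap-tri (tri x y z p q r m) = tri z (≢-sym y) x r (Adj-sym q) p λ k →
    [ inj₂ ∘ inj₂ , [ inj₂ ∘ inj₁ ∘ Only-sym , inj₁ ]′ ]′ (m k)

  rot-tri : ∀ {a b c} → Tri a b c → Tri b c a
  rot-tri (tri x y z p q r m) = tri y (≢-sym z) (≢-sym x) q (Adj-sym r) (Adj-sym p) λ k →
    [ inj₂ ∘ inj₂ ∘ Only-sym , [ inj₁ , inj₂ ∘ inj₁ ∘ Only-sym ]′ ]′ (m k)

  -- Link v a b: the ends at v of the edges va and vb are matched.  ≈ relates edges on a common trail.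
  record Pairing : Set₁ where
    infix 4 _≈_
    field
      Link    : V → V → V → Set
      _≈_     : V × V → V × V → Set
      link-sym  : ∀ {v a b} → Link v a b → Link v b a
      link-uniq : ∀ {v a b b′} → a ≢ v → Link v a b → Link v a b′ → b ≡ b′
      link-max  : ∀ {c d v a b} → Opp c d → a ≢ v → b ≢ v → Only c v a → Only d v b
        → Link v a b
        ⊎ (∃ λ b′ → b′ ≢ b × b′ ≢ v × Only d v b′ × Link v a b′)
        ⊎ (∃ λ a′ → a′ ≢ a × a′ ≢ v × Only c v a′ × Link v a′ b)
      link⇒≈  : ∀ {v a b} → Link v a b → (v , a) ≈ (v , b)
      ≈-sym   : ∀ {e f} → e ≈ f → f ≈ e
      ≈-trans : ∀ {e f g} → e ≈ f → f ≈ g → e ≈ g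
      ≈-flip  : ∀ {u v e} → (u , v) ≈ e → (v , u) ≈ e

  -- Satisfied triangles and forced links at a vertex.

  module _ (π : Pairing) where
    open Pairing π

    SatAt : V → V → V → Set
    SatAt u v w = ∃₂ λ c d → Opp c d × Only c u v × Only d u w × (u , v) ≈ (u , w)

    Sat : V → V → V → Set
    Sat a b c = SatAt a b c ⊎ SatAt b c a ⊎ SatAt c a b

  module Local {π : Pairing} where
    open Pairing π

    satAt-sym : ∀ {u v w} → SatAt π u v w → SatAt π u w v
    satAt-sym (c , d , o , p , q , e) = d , c , Opp-sym o , q , p , ≈-sym e

    swap-sat : ∀ {a b c} → Sat π a b c → Sat π a c b
    swap-sat (inj₁ s)        = inj₁ (satAt-sym s)
    swap-sat (inj₂ (inj₁ s)) = inj₂ (inj₂ (satAt-sym s))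
    swap-sat (inj₂ (inj₂ s)) = inj₂ (inj₁ (satAt-sym s))

    rot-sat : ∀ {a b c} → Sat π a b c → Sat π b c a
    rot-sat (inj₁ s)        = inj₂ (inj₂ s)
    rot-sat (inj₂ (inj₁ s)) = inj₁ s
    rot-sat (inj₂ (inj₂ s)) = inj₂ (inj₁ s)

    ≈-flipʳ : ∀ {u v e} → e ≈ (u , v) → e ≈ (v , u)
    ≈-flipʳ = ≈-sym ∘ ≈-flip ∘ ≈-sym

    link-sat : ∀ {c d v a b} → Opp c d → Only c v a → Only d v b → Link v a b → SatAt π v a b
    link-sat o p q l = _ , _ , o , p , q , link⇒≈ l

    -- Otherwise maximality would pair both `va` and `vb` with ends of colour `d` other than `vg`,
    -- and degree 2 leaves only one such end.
    full : ∀ {c d v a b g} → Opp c d → a ≢ b → a ≢ v → b ≢ v → g ≢ v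
      → Only c v a → Only c v b → Only d v g → Link v g a ⊎ Link v g b
    full o a≢b a≢v b≢v g≢v p q r with link-max o a≢v g≢v p r
    ... | inj₁ l = inj₁ (link-sym l)
    ... | inj₂ (inj₂ (a′ , a′≢a , _ , p′ , l)) =
      inj₂ (link-sym (subst (λ z → Link _ z _) (third (inj₁ p) (inj₁ q) a≢b (inj₁ p′) a′≢a) l))
    ... | inj₂ (inj₁ (g′ , g′≢g , g′≢v , r′ , l)) with link-max o b≢v g≢v q r
    ...   | inj₁ l′ = inj₂ (link-sym l′)
    ...   | inj₂ (inj₂ (b′ , b′≢b , _ , p′ , l′)) =
      inj₁ (link-sym (subst (λ z → Link _ z _) (third (inj₁ q) (inj₁ p) (≢-sym a≢b) (inj₁ p′) b′≢b) l′))
    ...   | inj₂ (inj₁ (g″ , g″≢g , _ , r″ , l′))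
      with refl ← third (inj₁ r) (inj₁ r′) (≢-sym g′≢g) (inj₁ r″) g″≢g
      = ⊥-elim (a≢b (link-uniq g′≢v (link-sym l) (link-sym l′)))

    -- Each colour has at most two edges at `v`. With `va` and `vb` used on each other, the only
    -- possible partners left for `vu` and `vw` are each other.
    rest-link : ∀ {c d v a b u w} → Opp c d → a ≢ v → b ≢ v → u ≢ v → w ≢ v
      → Only c v a → Only d v b → Link v a b
      → Only c v u → Only d v w → u ≢ a → w ≢ b → Link v u w
    rest-link o a≢v b≢v u≢v w≢v p q l r s u≢a w≢b with link-max o u≢v w≢v r s
    ... | inj₁ l′ = l′
    ... | inj₂ (inj₁ (b′ , b′≢w , _ , s′ , l′))
      with refl ← third (inj₁ s) (inj₁ q) w≢b (inj₁ s′) b′≢w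
      = ⊥-elim (u≢a (link-uniq b≢v (link-sym l′) (link-sym l)))
    ... | inj₂ (inj₂ (a′ , a′≢u , _ , r′ , l′))
      with refl ← third (inj₁ r) (inj₁ p) u≢a (inj₁ r′) a′≢u
      = ⊥-elim (w≢b (link-uniq a≢v l′ l))

    -- Beside `va` and `vb` each colour has room for one more edge at `v`, so `vu` and `vw` have
    -- opposite colours and neither is common; then `rest-link` applies.
    rest-sat : ∀ {c d v a b u w} → Opp c d → a ≢ v → b ≢ v → u ≢ v → w ≢ v
      → Only c v a → Only d v b → Link v a b → Adj v u → Adj v w
      → u ≢ a → u ≢ b → w ≢ a → w ≢ b → u ≢ w → SatAt π v u w
    rest-sat o a≢v b≢v u≢v w≢v p q l eu ew u≢a u≢b w≢a w≢b u≢w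
      with classify o eu
    ... | inj₁ hu = link-sat o ou ow (rest-link o a≢v b≢v u≢v w≢v p q l ou ow u≢a w≢b)
      where
        ow : Only _ _ _
        ow = other-only o (inj₁ p) hu (≢-sym u≢a) ew w≢a (≢-sym u≢w)
        ou : Only _ _ _
        ou = other-only (Opp-sym o) (inj₁ q) (inj₁ ow) (≢-sym w≢b) eu u≢b u≢w
    ... | inj₂ ou = satAt-sym (link-sat o ow ou (rest-link o a≢v b≢v w≢v u≢v p q l ow ou w≢a u≢b))
      where
        ow : Only _ _ _
        ow = other-only (Opp-sym o) (inj₁ q) (inj₁ ou) (≢-sym u≢b) ew w≢b (≢-sym u≢w)

    -- Around a vertex with one prescribed link a–b, the remaining two edges are linked as
    -- well, so only the triangles using exactly one of a, b need attention.
    at-link : ∀ {c d v a b} (P : V → Set) → Opp c d → a ≢ v → b ≢ v → Only c v a → Only d v b → Link v a b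
      → (∀ {w} → P w → w ≢ b → Tri v a w → Sat π v a w)
      → (∀ {w} → P w → w ≢ a → Tri v b w → Sat π v b w)
      → ∀ {u w} → P u → P w → Tri v u w → Sat π v u w
    at-link {a = a} {b} P o a≢v b≢v p q l fa fb {u} {w} pu pw t
      with u ≟ a | u ≟ b | w ≟ a | w ≟ b
    ... | yes refl | _ | _ | yes refl = inj₁ (link-sat o p q l)
    ... | yes refl | _ | _ | no w≢b = fa pw w≢b t
    ... | no _ | yes refl | yes refl | _ = inj₁ (satAt-sym (link-sat o p q l))
    ... | no _ | yes refl | no w≢a | _ = fb pw w≢a t
    ... | no _ | no u≢b | yes refl | _ = swap-sat (fa pu u≢b (swap-tri t))
    ... | no u≢a | no _ | no _ | yes refl = swap-sat (fb pu u≢a (swap-tri t))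
    ... | no u≢a | no u≢b | no w≢a | no w≢b =
      inj₁ (rest-sat o a≢v b≢v (≢-sym (a≢b t)) (≢-sym (a≢c t)) p q l (ab t) (ac t) u≢a u≢b w≢a w≢b (b≢c t))

    -- The common edge `xy` counts for both colours, so `xv` is the one edge at `x` of colour `c`
    -- alone and `xw` the one of colour `d` alone. Maximality must match these two.
    forced-sat : ∀ {c d v x y w} → Opp c d → v ≢ x → y ≢ v → Only c x v → st x y ≡ both
      → Adj x w → w ≢ x → w ≢ v → w ≢ y → SatAt π x v w
    forced-sat {c} {d} {v} {x} {y} {w} o v≢x y≢v xv xy ew w≢x w≢v w≢y = go (link-max o v≢x w≢x xv xw)
      where
        xw : Only d x w
        xw = other-only o (inj₁ xv) (inj₂ xy) (≢-sym y≢v) ew w≢v w≢y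
        go : _ ⊎ _ ⊎ _ → _
        go (inj₁ l) = link-sat o xv xw l
        go (inj₂ (inj₁ (b′ , b′≢w , _ , xb′ , _)))
          with refl ← third (inj₁ xw) (inj₂ xy) w≢y (inj₁ xb′) b′≢w
          with () ← trans (sym xy) xb′
        go (inj₂ (inj₂ (a′ , a′≢v , _ , xa′ , _)))
          with refl ← third (inj₁ xv) (inj₂ xy) (≢-sym y≢v) (inj₁ xa′) a′≢v
          with () ← trans (sym xy) xa′

  -- A mixed triangle without common edge; p is the vertex where its two edges of equal colour meet.
  record Mono (c d : Bool) (p x y : V) : Set where
    constructor mono
    field
      opp : Opp c d
      p≢x : p ≢ x
      p≢y : p ≢ y
      x≢y : x ≢ y
      px  : Only c p x
      py  : Only c p y
      xy  : Only d x y

    x≢p : x ≢ p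
    x≢p = ≢-sym p≢x
    y≢p : y ≢ p
    y≢p = ≢-sym p≢y
    y≢x : y ≢ x
    y≢x = ≢-sym x≢y
    xp : Only c x p
    xp = Only-sym px
    yp : Only c y p
    yp = Only-sym py
    yx : Only d y x
    yx = Only-sym xy

  mono-swap : ∀ {c d p x y} → Mono c d p x y → Mono c d p y x
  mono-swap (mono o a b e f g h) = mono o b a (≢-sym e) g f (Only-sym h)

  -- Triangles turned into loops.

  module Looped {π : Pairing} where
    open Pairing π
    open Local {π}

    loop-≈ : ∀ {c d p x y} → Mono c d p x y → Link x p y → Link y p x → (p , x) ≈ (p , y)
    loop-≈ m lx ly = ≈-trans (≈-flip (link⇒≈ lx)) (≈-flip (≈-sym (≈-flip (link⇒≈ ly))))

    -- `px` and `py` use up colour `c` at `p`, so `pg` has colour `d` and by `full` is matched with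
    -- one of them. The loop has both on one trail, so it does not matter which one.
    apex-≈ : ∀ {c d p x y g} → Mono c d p x y → Link x p y → Link y p x
      → Adj p g → g ≢ p → g ≢ x → g ≢ y → Only d p g × (p , x) ≈ (p , g)
    apex-≈ m lx ly pg g≢p g≢x g≢y = og , go (full opp x≢y x≢p y≢p g≢p px py og)
      where
        open Mono m
        og : Only _ _ _
        og = other-only opp (inj₁ px) (inj₁ py) x≢y pg g≢x g≢y
        go : _ ⊎ _ → _
        go (inj₁ l) = ≈-sym (link⇒≈ l)
        go (inj₂ l) = ≈-trans (loop-≈ m lx ly) (≈-sym (link⇒≈ l))

    apex-sat : ∀ {c d p x y g} → Mono c d p x y → Link x p y → Link y p x
      → Adj p g → g ≢ p → g ≢ x → g ≢ y → SatAt π p x g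
    apex-sat m lx ly pg g≢p g≢x g≢y with apex-≈ m lx ly pg g≢p g≢x g≢y
    ... | og , e = _ , _ , Mono.opp m , Mono.px m , og , e

    -- `pq` lies on the trail of the loop, hence together with `xy`. At `q`, `full` either continues
    -- this trail from `qp` into an edge `qx` or `qy` of colour `c`, or matches `qx` with `qy`
    -- directly.
    base-sat-c : ∀ {c d p x y q} → Mono c d p x y → Link x p y → Link y p x
      → Adj p q → q ≢ p → q ≢ x → q ≢ y → Only c x q → Only c y q ⊎ Only d y q → Sat π x y q
    base-sat-c {c} {d} {p} {x} {y} {q} m lx ly pq q≢p q≢x q≢y xq yq with apex-≈ m lx ly pq q≢p q≢x q≢y
    ... | og , e = go yq
      where
        open Mono m
        xy≈qp : (x , y) ≈ (q , p)
        xy≈qp = ≈-trans (≈-sym (link⇒≈ lx)) (≈-flip (≈-flipʳ e))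
        sat-x : (q , p) ≈ (q , x) → Sat π x y q
        sat-x f = inj₁ (_ , _ , Opp-sym opp , xy , xq , ≈-trans xy≈qp (≈-flipʳ f))
        go : Only c y q ⊎ Only d y q → Sat π x y q
        go (inj₁ yq) with full opp x≢y (≢-sym q≢x) (≢-sym q≢y) (≢-sym q≢p) (Only-sym xq) (Only-sym yq) (Only-sym og)
        ... | inj₁ l = sat-x (link⇒≈ l)
        ... | inj₂ l = inj₂ (inj₁ (_ , _ , opp , yq , yx , ≈-sym (≈-flip (≈-trans xy≈qp (≈-flipʳ (link⇒≈ l))))))
        go (inj₂ yq) with full (Opp-sym opp) p≢y (≢-sym q≢p) (≢-sym q≢y) (≢-sym q≢x) (Only-sym og) (Only-sym yq) (Only-sym xq)
        ... | inj₁ l = sat-x (≈-sym (link⇒≈ l))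
        ... | inj₂ l = inj₂ (inj₂ (link-sat opp (Only-sym xq) (Only-sym yq) l))

    base-sat : ∀ {c d p x y q} → Mono c d p x y → Link x p y → Link y p x
      → Adj p q → q ≢ p → Tri x y q → st x q ≢ both → st y q ≢ both → Sat π x y q
    base-sat {c} {d} {p} {x} {y} {q} m lx ly pq q≢p t nx ny = go (kind nx (ac t)) (kind ny (bc t))
      where
        open Mono m
        kind : ∀ {u v} → st u v ≢ both → Adj u v → Only c u v ⊎ Only d u v
        kind nb e with classify opp e
        ... | inj₁ (inj₁ h) = inj₁ h
        ... | inj₁ (inj₂ h) = ⊥-elim (nb h)
        ... | inj₂ h        = inj₂ h
        q≢x : q ≢ x
        q≢x = ≢-sym (a≢c t)
        q≢y : q ≢ y
        q≢y = ≢-sym (b≢c t)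
        go : Only c x q ⊎ Only d x q → Only c y q ⊎ Only d y q → Sat π x y q
        go (inj₁ xq) yq        = base-sat-c m lx ly pq q≢p q≢x q≢y xq yq
        go (inj₂ xq) (inj₁ yq) =
          swap-sat (rot-sat (base-sat-c (mono-swap m) ly lx pq q≢p q≢y q≢x yq (inj₂ xq)))
        go (inj₂ xq) (inj₂ yq) with mix t c
        ... | inj₁ h        = ⊥-elim (Only-opp opp h (inj₁ xy))
        ... | inj₂ (inj₁ h) = ⊥-elim (Only-opp opp h (inj₁ yq))
        ... | inj₂ (inj₂ h) = ⊥-elim (Only-opp opp h (inj₁ xq))

  -- Prescriptions and the invariant.

  adj? : ∀ u v → Dec (Adj u v)
  adj? u v = ¬? ((st u v ≟ᵏ none))

  tri? : ∀ a b c → Dec (Tri a b c)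
  tri? a b c = map′
    (λ (p , q , r , s , t , u , m , m′) → tri p q r s t u λ { true → m ; false → m′ })
    (λ t → a≢b t , b≢c t , a≢c t , ab t , bc t , ac t , mix t true , mix t false)
    (¬? (a ≟ b) ×-dec ¬? (b ≟ c) ×-dec ¬? (a ≟ c) ×-dec adj? a b ×-dec adj? b c ×-dec adj? a c
      ×-dec colour? true ×-dec colour? false)
    where
      colour? : ∀ k → Dec (Only k a b ⊎ Only k b c ⊎ Only k a c)
      colour? k = (st a b ≟ᵏ only k) ⊎-dec (st b c ≟ᵏ only k) ⊎-dec (st a c ≟ᵏ only k)

  -- (v , a , b) prescribes Link v a b.
  Prescription : Set
  Prescription = V × V × V

  keys : List Prescription → List V
  keys = map proj₁

  Valid : Prescription → Set
  Valid (v , a , b) = ∃₂ λ c d → Opp c d × a ≢ v × b ≢ v × Only c v a × Only d v b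

  Holds : Pairing → Prescription → Set
  Holds π (v , a , b) = Pairing.Link π v a b

  -- `robust` quantifies over every pairing that obeys `Δ`, so prescriptions added later cannot undo
  -- it. It speaks of the first vertex only, since `Tri` and `Sat` can be rotated.
  record State (Δ : List Prescription) : Set₁ where
    field
      valid  : All Valid Δ
      unique : Unique (keys Δ)
      robust : ∀ π → All (Holds π) Δ → ∀ {a b c} → a ∈ keys Δ → Tri a b c → Sat π a b c

  _∈?_ : (v : V) (vs : List V) → Dec (v ∈ vs)
  _∈?_ = member? _≟_

  -- Extending a prescription.

  module Steps {Δ : List Prescription} (state : State Δ) where
    open State state
    open Local using (swap-sat; rot-sat; satAt-sym; link-sat; at-link; rest-link; forced-sat; full)
    open Looped using (apex-sat; base-sat)
    open Pairing using (link⇒≈)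

    Free : V → Set
    Free v = v ∉ keys Δ

    -- `δ` is kept apart so that every extension is strictly longer, which makes the iteration
    -- terminate.
    Progress : Set₁
    Progress = ∃₂ λ δ new → State (δ ∷ new ++ Δ)

    -- A triangle with a vertex in `keys Δ` is settled by `robust`, so `sat` concerns only triangles
    -- whose other two vertices are free as well.
    extend : ∀ δ new → All Valid (δ ∷ new) → Unique (keys (δ ∷ new)) → All Free (keys (δ ∷ new))
      → (∀ π → All (Holds π) (δ ∷ new) → All (λ v → ∀ {b c} → Free b → Free c → Tri v b c → Sat π v b c) (keys (δ ∷ new)))
      → Progress
    extend δ new val uni free sat = δ , new , record
      { valid  = AllP.++⁺ val valid
      ; unique = subst Unique (sym (map-++ proj₁ (δ ∷ new) Δ))
          (Unique.++⁺ uni unique λ (i , j) → All.lookup free i j)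
      ; robust = robust′
      }
      where
        robust′ : ∀ π → All (Holds π) (δ ∷ new ++ Δ) → ∀ {a b c} → a ∈ keys (δ ∷ new ++ Δ) → Tri a b c → Sat π a b c
        robust′ π holds {a} {b} {c} i t with AllP.++⁻ (δ ∷ new) holds
        ... | hnew , hΔ with ∈-++⁻ (keys (δ ∷ new)) (subst (a ∈_) (map-++ proj₁ (δ ∷ new) Δ) i)
        ...   | inj₂ j = robust π hΔ j t
        ...   | inj₁ j with b ∈? keys Δ | c ∈? keys Δ
        ...     | yes bΔ | _ = rot-sat {π} (rot-sat {π} (robust π hΔ bΔ (rot-tri t)))
        ...     | no _ | yes cΔ = rot-sat {π} (robust π hΔ cΔ (rot-tri (rot-tri t)))
        ...     | no fb | no fc = All.lookup (sat π hnew) j fb fc t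

    -- A further triangle `vxw` or `vyw` is satisfied at `x` or `y`, where the common edge `xy`
    -- forces the match.
    common-step : ∀ {c d v x y} → Opp c d → Free v → Tri v x y → Only c v x → Only d v y → st x y ≡ both → Progress
    common-step {c} {d} {v} {x} {y} o fv t vx vy xy =
      extend (v , x , y) [] ((_ , _ , o , ≢-sym (a≢b t) , ≢-sym (a≢c t) , vx , vy) ∷ []) ([] ∷ []) (fv ∷ [])
        λ { π (l ∷ []) → at-link {π} Free o (≢-sym (a≢b t)) (≢-sym (a≢c t)) vx vy l
              (λ _ w≢y s → inj₂ (inj₁ (satAt-sym {π} (forced-sat {π} o (a≢b t) (≢-sym (a≢c t)) (Only-sym vx) xy
                 (bc s) (≢-sym (b≢c s)) (≢-sym (a≢c s)) w≢y))))
              (λ _ w≢x s → inj₂ (inj₁ (satAt-sym {π} (forced-sat {π} (Opp-sym o) (a≢c t) (≢-sym (a≢b t)) (Only-sym vy)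
                 (trans (st-sym _ _) xy) (bc s) (≢-sym (b≢c s)) (≢-sym (a≢c s)) w≢x)))) ∷ [] }

    NoCommon : Set
    NoCommon = ∀ {a b c} → Free a → Free b → Free c → Tri a b c → st b c ≢ both

    -- The loop of pxy at p reaches q when pq is an edge, and then satisfies xyq as well.
    Bad : V → V → V → V → Set
    Bad p x y q = Free q × q ≢ p × Tri x y q × ¬ Adj p q

    -- Further triangles through `px` or `py` are satisfied at `p`, where the loop meets every other
    -- edge. In a further triangle `xyw` the vertex `w` is not bad, so `pw` is an edge and
    -- `base-sat` applies; `nc` excludes common edges there.
    loop-step : NoCommon → ∀ {c d p x y} → Mono c d p x y → Free x → Free y
      → (∀ q → ¬ Bad p x y q) → Progress
    loop-step nc {p = p} {x} {y} m fx fy good =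
      extend (x , p , y) ((y , p , x) ∷ [])
        ((_ , _ , opp , p≢x , y≢x , xp , xy) ∷ (_ , _ , opp , p≢y , x≢y , yp , yx) ∷ [])
        ((x≢y ∷ []) ∷ [] ∷ []) (fx ∷ fy ∷ [])
        λ { π (lx ∷ ly ∷ []) →
            at-link {π} Free opp p≢x y≢x xp xy lx
              (λ _ w≢y t → inj₂ (inj₁ (satAt-sym {π} (apex-sat {π} m lx ly (bc t) (≢-sym (b≢c t)) (≢-sym (a≢c t)) w≢y))))
              (λ fw w≢p t → base π lx ly fw w≢p t)
          ∷ at-link {π} Free opp p≢y x≢y yp yx ly
              (λ _ w≢x t → inj₂ (inj₁ (satAt-sym {π} (apex-sat {π} (mono-swap m) ly lx (bc t) (≢-sym (b≢c t)) (≢-sym (a≢c t)) w≢x))))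
              (λ fw w≢p t → swap-sat {π} (rot-sat {π} (base π lx ly fw w≢p (swap-tri (rot-tri t)))))
          ∷ [] }
      where
        open Mono m
        base : ∀ π → Pairing.Link π x p y → Pairing.Link π y p x → ∀ {w} → Free w → w ≢ p → Tri x y w → Sat π x y w
        base π lx ly {w} fw w≢p t with st p w in eq
        ... | none = ⊥-elim (good w (fw , w≢p , t , λ e → e eq))
        ... | both = base-sat {π} m lx ly (λ e → case trans (sym e) eq of λ ()) w≢p t
                       (nc fy fx fw (swap-tri (rot-tri t))) (nc fx fy fw t)
        ... | only k = base-sat {π} m lx ly (λ e → case trans (sym e) eq of λ ()) w≢p t
                       (nc fy fx fw (swap-tri (rot-tri t))) (nc fx fy fw t)

    -- The triangles pxw that the path pxyq could leave unsatisfied.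
    Risk : V → V → V → Set
    Risk p x y = ∃ λ w → w ≢ p × w ≢ x × w ≢ y × Adj x w × Adj p w

    -- `p` and `q` are the only neighbours of `x` and of `y` in colour `c`, and `xy` has colour `d`.
    -- So a mixed triangle over `xy` has third vertex `p` or `q`, and `xyq` is satisfied at `y`.
    chord-sat : ∀ π {c d p q x y} → Mono c d p x y → Mono c d q x y → p ≢ q → Pairing.Link π y q x
      → ∀ {w} → w ≢ p → Tri x y w → Sat π x y w
    chord-sat π {c} {q = q} mp mq p≢q ly {w} w≢p t with w ≟ q
    ... | yes refl = inj₂ (inj₁ (link-sat {π} (Mono.opp mp) (Mono.yp mq) (Mono.yx mp) ly))
    ... | no w≢q with mix t c
    ...   | inj₁ h = ⊥-elim (Only-opp (Mono.opp mp) h (inj₁ (Mono.xy mp)))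
    ...   | inj₂ (inj₁ h) = ⊥-elim (w≢q (third (inj₁ (Mono.yp mp)) (inj₁ (Mono.yp mq)) p≢q (inj₁ h) w≢p))
    ...   | inj₂ (inj₂ h) = ⊥-elim (w≢q (third (inj₁ (Mono.xp mp)) (inj₁ (Mono.xp mq)) p≢q (inj₁ h) w≢p))

    -- The path `pxyq` satisfies both mixed triangles over `xy`, and without risk no other triangle
    -- contains `px` or `yq`.
    cross-step : ∀ {c d p q x y} → Mono c d p x y → Mono c d q x y → p ≢ q → Free x → Free y
      → ¬ Risk p x y → ¬ Risk q y x → Progress
    cross-step {p = p} {q} {x} {y} mp mq p≢q fx fy ¬r₁ ¬r₂ =
      extend (x , p , y) ((y , q , x) ∷ [])
        ((_ , _ , opp , p≢x , y≢x , xp , xy) ∷ (_ , _ , opp , Mono.p≢y mq , x≢y , Mono.yp mq , yx) ∷ [])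
        ((x≢y ∷ []) ∷ [] ∷ []) (fx ∷ fy ∷ [])
        λ { π (lx ∷ ly ∷ []) →
            at-link {π} Free opp p≢x y≢x xp xy lx
              (λ _ w≢y t → ⊥-elim (¬r₁ (_ , ≢-sym (b≢c t) , ≢-sym (a≢c t) , w≢y , ac t , bc t)))
              (λ _ → chord-sat π mp mq p≢q ly)
          ∷ at-link {π} Free opp (Mono.p≢y mq) x≢y (Mono.yp mq) yx ly
              (λ _ w≢x t → ⊥-elim (¬r₂ (_ , ≢-sym (b≢c t) , ≢-sym (a≢c t) , w≢x , ac t , bc t)))
              (λ _ → chord-sat π (mono-swap mq) (mono-swap mp) (≢-sym p≢q) lx)
          ∷ [] }
      where open Mono mp

    -- The path `pxyq` is prescribed together with the pair `px`-`pz` at `p`. By degrees, `z` is the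
    -- only further neighbour of `x` and `w` the only one of `y`. What remains is `pxz`, satisfied
    -- at `p`; `yqw`, where `w` would have three edges of colour `d`; and `pzw`, treated in
    -- `at-p-z`.
    double-risk-step : ∀ {c d p q x y} → Mono c d p x y → Mono c d q x y → p ≢ q → ¬ Adj p q
      → Free p → Free x → Free y → Risk p x y → Risk p y x → Progress
    double-risk-step {c} {d} {p} {q} {x} {y} mp mq p≢q ¬pq fp fx fy
      (z , z≢p , z≢x , z≢y , az , apz) (w , w≢p , w≢y , w≢x , aw , apw) =
      extend (x , p , y) ((y , q , x) ∷ (p , x , z) ∷ [])
        ( (_ , _ , opp , p≢x , y≢x , xp , xy)
        ∷ (_ , _ , opp , Mono.p≢y mq , x≢y , Mono.yp mq , yx)
        ∷ (_ , _ , opp , x≢p , z≢p , px , pz) ∷ [])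
        ((x≢y ∷ x≢p ∷ []) ∷ (y≢p ∷ []) ∷ [] ∷ []) (fx ∷ fy ∷ fp ∷ [])
        λ { π (lx ∷ ly ∷ lp ∷ []) →
            at-link {π} Free opp p≢x y≢x xp xy lx
              (λ _ → at-x-p π lp)
              (λ _ → chord-sat π mp mq p≢q ly)
          ∷ at-link {π} Free opp (Mono.p≢y mq) x≢y (Mono.yp mq) yx ly
              (λ _ → at-y-q π)
              (λ _ → chord-sat π (mono-swap mq) (mono-swap mp) (≢-sym p≢q) lx)
          ∷ at-link {π} Free opp x≢p z≢p px pz lp
              (λ _ → at-p-x π lx)
              (λ _ → at-p-z π ly lp)
          ∷ [] }
      where
        open Mono mp
        yq : Only c y q
        yq = Mono.yp mq
        z≢q : z ≢ q
        z≢q refl = ¬pq apz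
        w≢q : w ≢ q
        w≢q refl = ¬pq apw
        xz : Only d x z
        xz = other-only opp (inj₁ xp) (inj₁ (Mono.xp mq)) p≢q az z≢p z≢q
        yw : Only d y w
        yw = other-only opp (inj₁ yp) (inj₁ yq) p≢q aw w≢p w≢q
        pz : Only d p z
        pz = other-only opp (inj₁ px) (inj₁ py) x≢y apz z≢x z≢y
        pw : Only d p w
        pw = other-only opp (inj₁ px) (inj₁ py) x≢y apw w≢x w≢y
        -- Otherwise `z` would have three edges of colour `d`, to `x`, `y` and `p`.
        z≢w : z ≢ w
        z≢w refl = deg≤2 (inj₁ (Only-sym xz)) (inj₁ (Only-sym yw)) (inj₁ (Only-sym pz)) x≢y x≢p y≢p

        x-nbr : ∀ {g} → Adj x g → g ≢ p → g ≢ q → g ≢ y → g ≡ z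
        x-nbr e g≢p g≢q g≢y = third (inj₁ xy) (inj₁ xz) (≢-sym z≢y)
          (inj₁ (other-only opp (inj₁ xp) (inj₁ (Mono.xp mq)) p≢q e g≢p g≢q)) g≢y
        y-nbr : ∀ {g} → Adj y g → g ≢ p → g ≢ q → g ≢ x → g ≡ w
        y-nbr e g≢p g≢q g≢x = third (inj₁ yx) (inj₁ yw) (≢-sym w≢x)
          (inj₁ (other-only opp (inj₁ yp) (inj₁ yq) p≢q e g≢p g≢q)) g≢x
        p-adj≢q : ∀ {g} → Adj p g → g ≢ q
        p-adj≢q e refl = ¬pq e

        at-x-p : ∀ π → Pairing.Link π p x z → ∀ {g} → g ≢ y → Tri x p g → Sat π x p g
        at-x-p π lp g≢y t with refl ← x-nbr (ac t) (≢-sym (b≢c t)) (p-adj≢q (bc t)) g≢y =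
          inj₂ (inj₁ (satAt-sym {π} (link-sat {π} opp px pz lp)))

        at-y-q : ∀ π {g} → g ≢ x → Tri y q g → Sat π y q g
        at-y-q π {g} g≢x t with g ≟ p
        ... | yes refl = ⊥-elim (¬pq (Adj-sym (bc t)))
        ... | no g≢p with refl ← y-nbr (ac t) g≢p (≢-sym (b≢c t)) g≢x =
          ⊥-elim (deg≤2 (inj₁ (Only-sym yw)) (inj₁ (Only-sym pw)) (inj₁ (Only-sym qw)) y≢p (Mono.y≢p mq) p≢q)
          where
            qw : Only d q w
            qw = other-only opp (inj₁ (Mono.px mq)) (inj₁ (Mono.py mq)) x≢y (bc t) w≢x w≢y

        at-p-x : ∀ π → Pairing.Link π x p y → ∀ {g} → g ≢ z → Tri p x g → Sat π p x g
        at-p-x π lx {g} g≢z t with g ≟ y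
        ... | yes refl = inj₂ (inj₁ (satAt-sym {π} (link-sat {π} opp xp xy lx)))
        ... | no g≢y = ⊥-elim (g≢z (x-nbr (bc t) (≢-sym (a≢c t)) (p-adj≢q (ac t)) g≢y))

        -- The trail w–p–y–w closes up at w, so the edge wz meets it whichever way w is paired.
        at-p-z : ∀ π → Pairing.Link π y q x → Pairing.Link π p x z → ∀ {g} → g ≢ x → Tri p z g → Sat π p z g
        at-p-z π ly lp {g} g≢x t with g ≟ y
        ... | yes refl = ⊥-elim (z≢w (y-nbr (Adj-sym (bc t)) z≢p z≢q z≢x))
        ... | no g≢y
          with refl ← third (inj₁ pz) (inj₁ pw) z≢w
                 (inj₁ (other-only opp (inj₁ px) (inj₁ py) x≢y (ac t) g≢x g≢y)) (≢-sym (b≢c t))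
          = inj₂ (inj₂ (_ , _ , Opp-sym opp , Only-sym pw , wz , wp≈wz))
          where
            open Pairing π using (_≈_; ≈-sym; ≈-trans; ≈-flip)
            zw : Only c z w
            zw with mix t c
            ... | inj₁ h        = ⊥-elim (Only-opp opp h (inj₁ pz))
            ... | inj₂ (inj₁ h) = h
            ... | inj₂ (inj₂ h) = ⊥-elim (Only-opp opp h (inj₁ pw))
            wz : Only c w z
            wz = Only-sym zw
            wp≈wz : (w , p) ≈ (w , z)
            wp≈wz with full {π} (Opp-sym opp) p≢y (≢-sym w≢p) (≢-sym w≢y) z≢w (Only-sym pw) (Only-sym yw) wz
            ... | inj₁ l = ≈-sym (link⇒≈ π l)
            ... | inj₂ l = ≈-trans (≈-flip (≈-sym (link⇒≈ π
                    (rest-link {π} opp x≢p z≢p y≢p w≢p px pz lp py pw y≢x (≢-sym z≢w)))))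
                  (≈-trans (≈-flip (link⇒≈ π
                    (rest-link {π} opp (Mono.p≢y mq) x≢y p≢y w≢y yq yx ly yp yw p≢q w≢x)))
                  (≈-flip (≈-sym (link⇒≈ π l))))

    -- `xy`, `xz` and `xw` all have colour `d`, so `z` and `w` coincide. This vertex would then have
    -- edges of colour `d` to `x`, `p` and `q`.
    risk-clash : ∀ {c d p q x y} → Mono c d p x y → Mono c d q x y → p ≢ q → ¬ Adj p q
      → Risk p x y → Risk q x y → ⊥
    risk-clash {d = d} {p} {q} {x} {y} mp mq p≢q ¬pq (z , z≢p , z≢x , z≢y , xz , pz) (w , w≢q , w≢x , w≢y , xw , qw)
      = clash (third (inj₁ (Mono.xy mp)) (inj₁ (nbr z≢p (λ { refl → ¬pq pz }) xz)) (≢-sym z≢y)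
                 (inj₁ (nbr (λ { refl → ¬pq (Adj-sym qw) }) w≢q xw)) w≢y)
      where
        nbr : ∀ {g} → g ≢ p → g ≢ q → Adj x g → Only d x g
        nbr g≢p g≢q e = other-only (Mono.opp mp) (inj₁ (Mono.xp mp)) (inj₁ (Mono.xp mq)) p≢q e g≢p g≢q
        apex : ∀ {c r g} → Mono c d r x y → g ≢ x → g ≢ y → Adj r g → Only d r g
        apex m g≢x g≢y e = other-only (Mono.opp m) (inj₁ (Mono.px m)) (inj₁ (Mono.py m)) (Mono.x≢y m) e g≢x g≢y
        clash : w ≡ z → ⊥
        clash refl = deg≤2 (inj₁ (Only-sym (nbr z≢p w≢q xz))) (inj₁ (Only-sym (apex mp z≢x z≢y pz)))
          (inj₁ (Only-sym (apex mq z≢x z≢y qw))) (Mono.x≢p mp) (Mono.x≢p mq) p≢q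

    risk? : ∀ p x y → Dec (Risk p x y)
    risk? p x y = any? λ w → ¬? (w ≟ p) ×-dec ¬? (w ≟ x) ×-dec ¬? (w ≟ y) ×-dec adj? x w ×-dec adj? p w

    -- The path `pxyq` has the risks `Risk p x y` and `Risk q y x`, the path `pyxq` the other two.
    -- If both paths are at risk, then either two risks concern the same apex, the case of
    -- `double-risk-step`, or two concern the same one of `x` and `y`, and they clash.
    chord-step : ∀ {c d p q x y} → Mono c d p x y → Mono c d q x y → p ≢ q → ¬ Adj p q
      → Free p → Free q → Free x → Free y → Progress
    chord-step {p = p} {q} {x} {y} mp mq p≢q ¬pq fp fq fx fy
      with risk? p x y | risk? q y x | risk? p y x | risk? q x y
    ... | no r₁  | no r₂  | _      | _      = cross-step mp mq p≢q fx fy r₁ r₂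
    ... | _      | _      | no r₁  | no r₂  = cross-step (mono-swap mp) (mono-swap mq) p≢q fy fx r₁ r₂
    ... | yes r₁ | _      | yes r₂ | _      = double-risk-step mp mq p≢q ¬pq fp fx fy r₁ r₂
    ... | _      | yes r₁ | _      | yes r₂ =
      double-risk-step mq mp (≢-sym p≢q) (¬pq ∘ Adj-sym) fq fx fy r₂ r₁
    ... | yes r₁ | _      | _      | yes r₂ = ⊥-elim (risk-clash mp mq p≢q ¬pq r₁ r₂)
    ... | _      | yes r₁ | yes r₂ | _      = ⊥-elim (risk-clash (mono-swap mp) (mono-swap mq) p≢q ¬pq r₂ r₁)

    -- The rim around `x` is `pyqz`. The pair `xq`-`xz` is not prescribed but forced by `rest-link`,
    -- so `qxz` becomes a loop at `q` as `pxy` does at `p`. Since `x` has no further neighbours and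
    -- `yz` is no edge, the other triangles over `xy` and `xz` are `xyq`, satisfied at `q`, and
    -- `xzp`, satisfied at `p`.
    wheel-step : ∀ {c d p q x y z} → Mono c d p x y → Mono c d q x z → p ≢ q → y ≢ z
      → Adj y q → Adj p z → ¬ Adj y z → q ≢ y → p ≢ z → Free x → Free y → Free z → Progress
    wheel-step {c} {d} {p} {q} {x} {y} {z} mp mq p≢q y≢z yq pz ¬yz q≢y p≢z fx fy fz =
      extend (x , p , y) ((y , p , x) ∷ (z , q , x) ∷ [])
        ( (_ , _ , opp , p≢x , y≢x , xp , xy)
        ∷ (_ , _ , opp , p≢y , x≢y , yp , yx)
        ∷ (_ , _ , opp , Q.p≢y , Q.x≢y , Q.yp , Q.yx) ∷ [])
        ((x≢y ∷ Q.x≢y ∷ []) ∷ (y≢z ∷ []) ∷ [] ∷ []) (fx ∷ fy ∷ fz ∷ [])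
        λ { π (lx ∷ ly ∷ lz ∷ []) →
            at-link {π} Free opp p≢x y≢x xp xy lx
              (λ _ w≢y t → inj₂ (inj₁ (satAt-sym {π} (apex-sat {π} mp lx ly (bc t) (≢-sym (b≢c t)) (≢-sym (a≢c t)) w≢y))))
              (λ _ → base π lx lz)
          ∷ at-link {π} Free opp p≢y x≢y yp yx ly
              (λ _ w≢x t → inj₂ (inj₁ (satAt-sym {π} (apex-sat {π} (mono-swap mp) ly lx (bc t) (≢-sym (b≢c t)) (≢-sym (a≢c t)) w≢x))))
              (λ _ w≢p t → swap-sat {π} (rot-sat {π} (base π lx lz w≢p (swap-tri (rot-tri t)))))
          ∷ at-link {π} Free opp Q.p≢y Q.x≢y Q.yp Q.yx lz
              (λ _ w≢x t → inj₂ (inj₁ (satAt-sym {π} (apex-sat {π} (mono-swap mq) lz (lq π lx) (bc t) (≢-sym (b≢c t)) (≢-sym (a≢c t)) w≢x))))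
              (λ _ → at-z π lx ly)
          ∷ [] }
      where
        open Mono mp
        module Q = Mono mq
        lq : ∀ π → Pairing.Link π x p y → Pairing.Link π x q z
        lq π lx = rest-link {π} opp p≢x y≢x Q.p≢x Q.y≢x xp xy lx Q.xp Q.xy (≢-sym p≢q) (≢-sym y≢z)
        x-nbr : ∀ {g} → Adj x g → g ≢ p → g ≢ q → Only d x g
        x-nbr e = other-only opp (inj₁ xp) (inj₁ Q.xp) p≢q e

        base : ∀ π → Pairing.Link π x p y → Pairing.Link π z q x → ∀ {g} → g ≢ p → Tri x y g → Sat π x y g
        base π lx lz {g} g≢p t with g ≟ q
        ... | yes refl = inj₂ (inj₂ (apex-sat {π} mq (lq π lx) lz (Adj-sym yq) (≢-sym q≢y) y≢x y≢z))
        ... | no g≢q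
          with refl ← third (inj₁ xy) (inj₁ Q.xy) y≢z (inj₁ (x-nbr (ac t) g≢p g≢q)) (≢-sym (b≢c t))
          = ⊥-elim (¬yz (bc t))

        at-z : ∀ π → Pairing.Link π x p y → Pairing.Link π y p x → ∀ {g} → g ≢ q → Tri z x g → Sat π z x g
        at-z π lx ly {g} g≢q t with g ≟ p
        ... | yes refl = inj₂ (inj₂ (satAt-sym {π} (apex-sat {π} mp lx ly pz (≢-sym p≢z) Q.y≢x (≢-sym y≢z))))
        ... | no g≢p
          with refl ← third (inj₁ Q.xy) (inj₁ xy) (≢-sym y≢z) (inj₁ (x-nbr (bc t) g≢p g≢q)) (≢-sym (a≢c t))
          = ⊥-elim (¬yz (Adj-sym (ac t)))

    -- Choosing the step.

    free? : ∀ v → Dec (Free v)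
    free? v = ¬? (v ∈? keys Δ)

    bad? : ∀ p x y → Dec (∃ (Bad p x y))
    bad? p x y = any? λ q → free? q ×-dec ¬? (q ≟ p) ×-dec tri? x y q ×-dec ¬? (adj? p q)

    coloured : NoCommon → ∀ {c d a u v} → Opp c d → Free a → Free u → Free v → Tri a u v → Only c u v ⊎ Only d u v
    coloured nc o fa fu fv t with classify o (bc t)
    ... | inj₁ (inj₁ h) = inj₁ h
    ... | inj₁ (inj₂ h) = ⊥-elim (nc fa fu fv t h)
    ... | inj₂ h        = inj₂ h

    -- The triangles around `x` are tried in turn: `xyq` as a loop at `y`, then `xqg` as a loop at
    -- `q`. Each bad vertex supplies the next triangle, and the degrees at `x` make the fourth one
    -- return to `p`.
    fan-step : NoCommon → ∀ {c d p q x y} → Mono c d p x y → Mono d c y x q → p ≢ q → ¬ Adj p q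
      → Free q → Free x → Free y → Progress
    fan-step nc {c} {d} {p} {q} {x} {y} mp m₂ p≢q ¬pq fq fx fy with bad? y x q
    ... | no good = loop-step nc m₂ fx fq λ g b → good (g , b)
    ... | yes (g , fg , g≢y , t , ¬yg) = go (coloured nc opp fx fq fg t)
      where
        open Mono mp
        g≢p : g ≢ p
        g≢p refl = ¬pq (Adj-sym (bc t))
        x-nbr : ∀ {h} → Adj x h → h ≢ p → h ≢ q → Only d x h
        x-nbr = other-only opp (inj₁ xp) (inj₁ (Mono.xy m₂)) p≢q
        xg : Only d x g
        xg = x-nbr (ac t) g≢p (≢-sym (b≢c t))
        go : Only c q g ⊎ Only d q g → Progress
        -- Now `y` and `g` are non-adjacent apexes over the same base `xq`, with the colours
        -- exchanged.
        go (inj₂ qg) = chord-step m₂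
          (mono (Opp-sym opp) (≢-sym (a≢c t)) (≢-sym (b≢c t)) (a≢b t) (Only-sym xg) (Only-sym qg) (Mono.xy m₂))
          (≢-sym g≢y) ¬yg fy fg fx fq
        go (inj₁ qg) with bad? q x g
        ... | no good = loop-step nc m₅ fx fg λ h b → good (h , b)
          where
            m₅ : Mono c d q x g
            m₅ = mono opp (≢-sym (a≢b t)) (b≢c t) (a≢c t) (Only-sym (Mono.xy m₂)) qg xg
        ... | yes (h , fh , h≢q , t′ , ¬qh) with h ≟ p
        ...   | yes refl = wheel-step mp
                  (mono opp (≢-sym (a≢b t)) (b≢c t) (a≢c t) (Only-sym (Mono.xy m₂)) qg xg)
                  p≢q (≢-sym g≢y) (Only⇒Adj (Mono.py m₂)) (Adj-sym (bc t′)) ¬yg (Mono.y≢p m₂) (≢-sym g≢p) fx fy fg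
        -- The neighbours of `x` in colour `d` are `y` and `g`, so `h` would be `y`, but `yg` is no
        -- edge.
        ...   | no h≢p
          with refl ← third (inj₁ xg) (inj₁ xy) g≢y (inj₁ (x-nbr (ac t′) h≢p h≢q)) (≢-sym (b≢c t′))
          = ⊥-elim (¬yg (Adj-sym (bc t′)))

    mono-step : NoCommon → ∀ {c d p x y} → Mono c d p x y → Free p → Free x → Free y → Progress
    mono-step nc {c} {d} {p} {x} {y} mp fp fx fy with bad? p x y
    ... | no good = loop-step nc mp fx fy λ q b → good (q , b)
    ... | yes (q , fq , q≢p , t , ¬pq) =
      go (coloured nc opp fy fx fq (swap-tri (rot-tri t))) (coloured nc opp fx fy fq t)
      where
        open Mono mp
        go : Only c x q ⊎ Only d x q → Only c y q ⊎ Only d y q → Progress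
        go (inj₁ xq) (inj₁ yq) = chord-step mp
          (mono opp (≢-sym (a≢c t)) (≢-sym (b≢c t)) x≢y (Only-sym xq) (Only-sym yq) xy) (≢-sym q≢p) ¬pq fp fq fx fy
        go (inj₁ xq) (inj₂ yq) = fan-step nc mp (mono (Opp-sym opp) y≢x (b≢c t) (a≢c t) yx yq xq) (≢-sym q≢p) ¬pq fq fx fy
        go (inj₂ xq) (inj₁ yq) =
          fan-step nc (mono-swap mp) (mono (Opp-sym opp) x≢y (a≢c t) (b≢c t) xy xq yq) (≢-sym q≢p) ¬pq fq fy fx
        go (inj₂ xq) (inj₂ yq) with mix t c
        ... | inj₁ h        = ⊥-elim (Only-opp opp h (inj₁ xy))
        ... | inj₂ (inj₁ h) = ⊥-elim (Only-opp opp h (inj₁ yq))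
        ... | inj₂ (inj₂ h) = ⊥-elim (Only-opp opp h (inj₁ xq))

    common-progress : ∀ {v x y} → Free v → Tri v x y → st x y ≡ both → Progress
    common-progress fv t xy with mix t true | mix t false
    ... | inj₂ (inj₁ h) | _ with () ← trans (sym xy) h
    ... | inj₁ _ | inj₂ (inj₁ h) with () ← trans (sym xy) h
    ... | inj₂ (inj₂ _) | inj₂ (inj₁ h) with () ← trans (sym xy) h
    ... | inj₁ h | inj₁ h′ = ⊥-elim (Only-opp red-blue h (inj₁ h′))
    ... | inj₂ (inj₂ h) | inj₂ (inj₂ h′) = ⊥-elim (Only-opp red-blue h (inj₁ h′))
    ... | inj₁ h | inj₂ (inj₂ h′) = common-step red-blue fv t h h′ xy
    ... | inj₂ (inj₂ h) | inj₁ h′ = common-step blue-red fv t h′ h xy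

    -- Without common edges every side has a single colour. Three equal colours are not mixed, so
    -- exactly two sides agree, and they meet at the apex.
    tri-progress : NoCommon → ∀ {u v w} → Free u → Free v → Free w → Tri u v w → Progress
    tri-progress nc {u} {v} {w} fu fv fw t =
      go (coloured nc red-blue fw fu fv (rot-tri (rot-tri t))) (coloured nc red-blue fu fv fw t)
         (coloured nc red-blue fv fu fw (swap-tri (rot-tri t)))
      where
        uv = a≢b t
        vw = b≢c t
        uw = a≢c t
        absurd : ∀ {c d} → Opp c d → Only d u v → Only d v w → Only d u w → Progress
        absurd {c} o p q r with mix t c
        ... | inj₁ h        = ⊥-elim (Only-opp o h (inj₁ p))
        ... | inj₂ (inj₁ h) = ⊥-elim (Only-opp o h (inj₁ q))
        ... | inj₂ (inj₂ h) = ⊥-elim (Only-opp o h (inj₁ r))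
        apex-u : ∀ {c d} → Opp c d → Only c u v → Only c u w → Only d v w → Progress
        apex-u o p q r = mono-step nc (mono o uv uw vw p q r) fu fv fw
        apex-v : ∀ {c d} → Opp c d → Only c u v → Only c v w → Only d u w → Progress
        apex-v o p q r = mono-step nc (mono o (≢-sym uv) vw uw (Only-sym p) q r) fv fu fw
        apex-w : ∀ {c d} → Opp c d → Only c u w → Only c v w → Only d u v → Progress
        apex-w o p q r = mono-step nc (mono o (≢-sym uw) (≢-sym vw) uv (Only-sym p) (Only-sym q) r) fw fu fv
        go : Only true u v ⊎ Only false u v → Only true v w ⊎ Only false v w → Only true u w ⊎ Only false u w → Progress
        go (inj₁ p) (inj₁ q) (inj₁ r) = absurd blue-red p q r
        go (inj₁ p) (inj₁ q) (inj₂ r) = apex-v red-blue p q r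
        go (inj₁ p) (inj₂ q) (inj₁ r) = apex-u red-blue p r q
        go (inj₁ p) (inj₂ q) (inj₂ r) = apex-w blue-red r q p
        go (inj₂ p) (inj₁ q) (inj₁ r) = apex-w red-blue r q p
        go (inj₂ p) (inj₁ q) (inj₂ r) = apex-u blue-red p r q
        go (inj₂ p) (inj₂ q) (inj₁ r) = apex-v blue-red p q r
        go (inj₂ p) (inj₂ q) (inj₂ r) = absurd red-blue p q r

    -- Triangles with a common edge are used up first, so that the steps for the others may assume
    -- `NoCommon`.
    progress : Progress ⊎ (∀ {a b c} → Free a → Free b → Free c → Tri a b c → ⊥)
    progress
      with any? (λ a → any? λ b → any? λ c → (free? a ×-dec free? b ×-dec free? c ×-dec tri? a b c) ×-dec (st b c ≟ᵏ both))
    ... | yes (a , b , c , (fa , _ , _ , t) , bc) = inj₁ (common-progress fa t bc)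
    ... | no ¬common with any? (λ a → any? λ b → any? λ c → free? a ×-dec free? b ×-dec free? c ×-dec tri? a b c)
    ...   | yes (a , b , c , fa , fb , fc , t) = inj₁ (tri-progress nc fa fb fc t)
      where
        nc : NoCommon
        nc fa fb fc t bc = ¬common (_ , _ , _ , (fa , fb , fc , t) , bc)
    ...   | no ¬tri = inj₂ λ fa fb fc t → ¬tri (_ , _ , _ , fa , fb , fc , t)

  -- Iterating the steps.

  record Solution : Set₁ where
    field
      links  : List Prescription
      valid  : All Valid links
      unique : Unique (keys links)
      sat    : ∀ π → All (Holds π) links → ∀ {a b c} → Tri a b c → Sat π a b c

  -- The keys are distinct vertices, so `length Δ` never exceeds `n`, while every step increases it.
  -- With no fuel left, `bound` therefore rules out a further step.
  solve-from : ∀ fuel {Δ} → State Δ → n ≤ fuel + length Δ → Solution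
  solve-from fuel {Δ} state bound with Steps.progress state
  ... | inj₂ ¬tri = record { links = Δ ; valid = State.valid state ; unique = State.unique state ; sat = sat′ }
    where
      open Local using (rot-sat)
      sat′ : ∀ π → All (Holds π) Δ → ∀ {a b c} → Tri a b c → Sat π a b c
      sat′ π holds {a} {b} {c} t with a ∈? keys Δ | b ∈? keys Δ | c ∈? keys Δ
      ... | yes i | _     | _     = State.robust state π holds i t
      ... | _     | yes i | _     = rot-sat {π} (rot-sat {π} (State.robust state π holds i (rot-tri t)))
      ... | _     | _     | yes i = rot-sat {π} (State.robust state π holds i (rot-tri (rot-tri t)))
      ... | no fa | no fb | no fc = ⊥-elim (¬tri fa fb fc t)
  solve-from zero {Δ} state bound | inj₁ (δ , new , state′) =
    ⊥-elim (<-irrefl refl (≤-trans (s≤s (≤-trans bound (≤-trans (m≤n+m _ (length new)) (≤-reflexive (sym (length-++ new))))))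
      (subst (_≤ n) (length-map proj₁ (δ ∷ new ++ Δ)) (unique-length≤ _ (State.unique state′)))))
  solve-from (suc fuel) {Δ} state bound | inj₁ (δ , new , state′) = solve-from fuel state′
    (≤-trans bound (≤-trans (s≤s (+-monoʳ-≤ fuel (≤-trans (m≤n+m _ (length new)) (≤-reflexive (sym (length-++ new))))))
      (≤-reflexive (sym (+-suc fuel _)))))

  solution : Solution
  solution = solve-from n record { valid = [] ; unique = [] ; robust = λ _ _ () } (m≤m+n n 0)

-- Sums, permutations and disjoint lists.

∑-cong : ∀ {m} {f g : Fin m → ℕ} → (∀ i → f i ≡ g i) → ∑ f ≡ ∑ g
∑-cong {zero}  f≗g = refl
∑-cong {suc m} f≗g = cong₂ _+_ (f≗g zero) (∑-cong (f≗g ∘ suc))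

length-concat-tabulate : ∀ {A : Set} {m} (g : Fin m → List A) → length (concat (tabulate g)) ≡ ∑ (length ∘ g)
length-concat-tabulate {m = zero}  g = refl
length-concat-tabulate {m = suc m} g =
  trans (length-++ (g zero)) (cong (length (g zero) +_) (length-concat-tabulate (g ∘ suc)))

concatMap-↭ : ∀ {A B : Set} (f : A → List B) {xs ys} → xs ↭ ys → concatMap f xs ↭ concatMap f ys
concatMap-↭ f refl         = refl
concatMap-↭ f (prep x p)     = ++⁺ˡ (f x) (concatMap-↭ f p)
concatMap-↭ f (swap x y p)   = ↭trans (shifts (f x) (f y)) (++⁺ˡ (f y) (++⁺ˡ (f x) (concatMap-↭ f p)))
concatMap-↭ f (↭trans p q)   = ↭trans (concatMap-↭ f p) (concatMap-↭ f q)

toSet⁺ : ∀ {m} {P : List (Fin m)} {e} → e ∈ P → toSet P e ≡ true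
toSet⁺ {e = e} (here refl) with e ≟ e
... | yes _ = refl
... | no ¬p = ⊥-elim (¬p refl)
toSet⁺ {P = f ∷ _} {e} (there i) with e ≟ f
... | yes _ = refl
... | no _  = toSet⁺ i

toSet⁻ : ∀ {m} (P : List (Fin m)) {e} → toSet P e ≡ true → e ∈ P
toSet⁻ (f ∷ P) {e} t with e ≟ f
... | yes p = here p
... | no _  = there (toSet⁻ P t)

unique-++⁻ʳ : ∀ {A : Set} (xs : List A) {ys} → Unique (xs ++ ys) → Unique ys
unique-++⁻ʳ []       u       = u
unique-++⁻ʳ (x ∷ xs) (_ ∷ u) = unique-++⁻ʳ xs u

unique-++⁻ˡ : ∀ {A : Set} (xs : List A) {ys} → Unique (xs ++ ys) → Unique xs
unique-++⁻ˡ []       _       = []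
unique-++⁻ˡ (x ∷ xs) (p ∷ u) = AllP.++⁻ˡ xs p ∷ unique-++⁻ˡ xs u

unique-++-disjoint : ∀ {A : Set} (xs : List A) {ys x} → Unique (xs ++ ys) → x ∈ xs → x ∈ ys → ⊥
unique-++-disjoint (x ∷ xs) (p ∷ _) (here refl) j = All.lookup p (∈-++⁺ʳ xs j) refl
unique-++-disjoint (x ∷ xs) (_ ∷ u) (there i)   j = unique-++-disjoint xs u i j

unique-member : ∀ {A : Set} {xss : List (List A)} {xs} → Unique (concat xss) → xs ∈ xss → Unique xs
unique-member {xss = xs ∷ _} u (here refl) = unique-++⁻ˡ xs u
unique-member {xss = xs ∷ _} u (there i)   = unique-member (unique-++⁻ʳ xs u) i

same-member : ∀ {A : Set} {xss : List (List A)} {xs ys x} → Unique (concat xss)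
  → xs ∈ xss → ys ∈ xss → x ∈ xs → x ∈ ys → xs ≡ ys
same-member u (here refl) (here refl) p q = refl
same-member {xss = xs ∷ _} u (here refl) (there j) p q = ⊥-elim (unique-++-disjoint xs u p (∈-concat⁺′ q j))
same-member {xss = ys ∷ _} u (there i) (here refl) p q = ⊥-elim (unique-++-disjoint ys u q (∈-concat⁺′ p i))
same-member {xss = xs ∷ _} u (there i) (there j) p q = same-member (unique-++⁻ʳ xs u) i j p q

-- Darts and degrees.

kind : Bool → Bool → Kind
kind true  true  = both
kind true  false = only true
kind false true  = only false
kind false false = none

-- A dart is an edge with a chosen end, so a loop has two darts at its vertex, as in deg.
module Darts {n m : ℕ} (G : Graph n m) where

  Dart : Set
  Dart = Fin m × Bool

  edge : Dart → Fin m
  edge = proj₁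

  tail : Dart → Fin n
  tail (e , false) = src G e
  tail (e , true)  = tgt G e

  flip : Dart → Dart
  flip (e , s) = e , not s

  head : Dart → Fin n
  head = tail ∘ flip

  flip-flip : ∀ d → flip (flip d) ≡ d
  flip-flip (e , s) = cong (e ,_) (not-involutive s)

  _≟ᵈ_ : (d d′ : Dart) → Dec (d ≡ d′)
  _≟ᵈ_ = ≡-dec _≟_ _≟ᵇ_

  joins : ∀ d → Joins G (edge d) (tail d) (head d)
  joins (e , false) = inj₁ (refl , refl)
  joins (e , true)  = inj₂ (refl , refl)

  joins⇒dart : ∀ {e u v} → Joins G e u v → ∃ λ s → tail (e , s) ≡ u × head (e , s) ≡ v
  joins⇒dart (inj₁ (p , q)) = false , p , q
  joins⇒dart (inj₂ (p , q)) = true , q , p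

  joins-unique : ∀ {e f u v} → Joins G e u v → Joins G f u v → e ≡ f
  joins-unique (inj₁ (p , q)) (inj₁ (r , s)) = noParallel G _ _ (inj₁ (trans p (sym r) , trans q (sym s)))
  joins-unique (inj₁ (p , q)) (inj₂ (r , s)) = noParallel G _ _ (inj₂ (trans p (sym s) , trans q (sym r)))
  joins-unique (inj₂ (p , q)) (inj₁ (r , s)) = noParallel G _ _ (inj₂ (trans p (sym s) , trans q (sym r)))
  joins-unique (inj₂ (p , q)) (inj₂ (r , s)) = noParallel G _ _ (inj₁ (trans p (sym r) , trans q (sym s)))

  joins-sym : ∀ {e u v} → Joins G e u v → Joins G e v u
  joins-sym (inj₁ p) = inj₂ p
  joins-sym (inj₂ p) = inj₁ p

  joins? : ∀ u v e → Dec (Joins G e u v)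
  joins? u v e = ((src G e ≟ u) ×-dec (tgt G e ≟ v)) ⊎-dec ((src G e ≟ v) ×-dec (tgt G e ≟ u))

  side-unique : ∀ {e} s s′ → tail (e , s) ≢ head (e , s) → tail (e , s′) ≡ tail (e , s) → s ≡ s′
  side-unique false false _  _ = refl
  side-unique true  true  _  _ = refl
  side-unique false true  ¬l t = ⊥-elim (¬l (sym t))
  side-unique true  false ¬l t = ⊥-elim (¬l (sym t))

  record Arc (u v : Fin n) (d : Dart) : Set where
    constructor arrow
    field
      tail≡ : tail d ≡ u
      head≡ : head d ≡ v
  open Arc

  arc-joins : ∀ {u v d} → Arc u v d → Joins G (edge d) u v
  arc-joins {d = d} (arrow refl refl) = joins d

  -- The absence of parallel edges determines the edge, and `u ≢ v` its direction.
  arc-unique : ∀ {u v d d′} → u ≢ v → Arc u v d → Arc u v d′ → d ≡ d′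
  arc-unique {d = e , s} {e′ , s′} u≢v x y
    with refl ← joins-unique (arc-joins x) (arc-joins y) | arrow refl refl ← x
    = cong (e ,_) (side-unique s s′ u≢v (tail≡ y))

  ends : Fin n → Fin m → List Dart
  ends v e = (if does (src G e ≟ v) then (e , false) ∷ [] else [])
          ++ (if does (tgt G e ≟ v) then (e , true) ∷ [] else [])

  block : EdgeSet m → Fin n → Fin m → List Dart
  block F v e = if F e then ends v e else []

  dartsAt : EdgeSet m → Fin n → List Dart
  dartsAt F v = concat (tabulate (block F v))

  length-dartsAt : ∀ F v → length (dartsAt F v) ≡ deg G F v
  length-dartsAt F v = trans (length-concat-tabulate (block F v)) (∑-cong eq)
    where
      eq : ∀ e → length (block F v e) ≡ (if F e then inc G v e else 0)
      eq e with F e | src G e ≟ v | tgt G e ≟ v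
      ... | false | _     | _     = refl
      ... | true  | yes _ | yes _ = refl
      ... | true  | yes _ | no _  = refl
      ... | true  | no _  | yes _ = refl
      ... | true  | no _  | no _  = refl

  ∈-block⁺ : ∀ {F v} d → F (edge d) ≡ true → tail d ≡ v → d ∈ block F v (edge d)
  ∈-block⁺ {F} {v} (e , s) Fe t with F e | Fe
  ∈-block⁺ {F} {v} (e , false) _ t | true | refl with src G e ≟ v
  ... | yes _ = here refl
  ... | no ¬t = ⊥-elim (¬t t)
  ∈-block⁺ {F} {v} (e , true) _ t | true | refl with tgt G e ≟ v
  ... | yes _ = ∈-++⁺ʳ (if does (src G e ≟ v) then _ else _) (here refl)
  ... | no ¬t = ⊥-elim (¬t t)

  ∈-block⁻ : ∀ {F v} e {d} → d ∈ block F v e → edge d ≡ e × F e ≡ true × tail d ≡ v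
  ∈-block⁻ {F} {v} e i with F e | src G e ≟ v | tgt G e ≟ v
  ∈-block⁻ e (here refl)         | true | yes p | _     = refl , refl , p
  ∈-block⁻ e (there (here refl)) | true | yes _ | yes q = refl , refl , q
  ∈-block⁻ e (here refl)         | true | no _  | yes q = refl , refl , q

  block-unique : ∀ F v e → Unique (block F v e)
  block-unique F v e with F e | src G e ≟ v | tgt G e ≟ v
  ... | false | _     | _     = []
  ... | true  | yes _ | yes _ = ((λ ()) ∷ []) ∷ [] ∷ []
  ... | true  | yes _ | no _  = [] ∷ []
  ... | true  | no _  | yes _ = [] ∷ []
  ... | true  | no _  | no _  = []

  ∈-dartsAt⁺ : ∀ {F v d} → F (edge d) ≡ true → tail d ≡ v → d ∈ dartsAt F v
  ∈-dartsAt⁺ {F} {v} {d} Fe t = ∈-concat⁺′ (∈-block⁺ {F} d Fe t) (∈-tabulate⁺ {f = block F v} (edge d))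

  ∈-dartsAt⁻ : ∀ {F v d} → d ∈ dartsAt F v → F (edge d) ≡ true × tail d ≡ v
  ∈-dartsAt⁻ {F} {v} i
    with _ , j , k ← ∈-concat⁻′ (tabulate (block F v)) i
    with e , refl ← ∈-tabulate⁻ {f = block F v} k
    with refl , Fe , t ← ∈-block⁻ {F} e j = Fe , t

  dartsAt-unique : ∀ F v → Unique (dartsAt F v)
  dartsAt-unique F v = Unique.concat⁺ (AllP.tabulate⁺ (block-unique F v))
    (AllPairs.tabulate⁺ λ i≢j (p , q) →
      i≢j (trans (sym (proj₁ (∈-block⁻ {F} _ p))) (proj₁ (∈-block⁻ {F} _ q))))

  -- Degrees count darts, so an injection of the darts at `v` compares them. The relation lets a
  -- dart be sent either to itself or to its mate.
  deg-inj : ∀ F F′ v (R : Dart → Dart → Set)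
    → (∀ {h} → F (edge h) ≡ true → tail h ≡ v → ∃ λ g → F′ (edge g) ≡ true × tail g ≡ v × R h g)
    → (∀ {h h′ g} → F (edge h) ≡ true → F (edge h′) ≡ true → R h g → R h′ g → h ≡ h′)
    → deg G F v ≤ deg G F′ v
  deg-inj F F′ v R img inj
    rewrite sym (length-dartsAt F v) | sym (length-dartsAt F′ v) =
    length-inj R (dartsAt F v) (dartsAt F′ v) (dartsAt-unique F v)
      (λ i → let Fe , t = ∈-dartsAt⁻ {F} i ; g , F′e , t′ , r = img Fe t in g , ∈-dartsAt⁺ {F′} F′e t′ , r)
      (λ i j → inj (proj₁ (∈-dartsAt⁻ {F} i)) (proj₁ (∈-dartsAt⁻ {F} j)))

  no-three-darts : ∀ {F v d₁ d₂ d₃} → deg G F v ≤ 2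
    → F (edge d₁) ≡ true → F (edge d₂) ≡ true → F (edge d₃) ≡ true
    → tail d₁ ≡ v → tail d₂ ≡ v → tail d₃ ≡ v → d₁ ≢ d₂ → d₁ ≢ d₃ → d₂ ≢ d₃ → ⊥
  no-three-darts {F} {v} {d₁} {d₂} {d₃} bound f₁ f₂ f₃ t₁ t₂ t₃ d₁₂ d₁₃ d₂₃ =
    <-irrefl refl (≤-trans three (≤-trans (≤-reflexive (length-dartsAt F v)) bound))
    where
      three : 3 ≤ length (dartsAt F v)
      three = length-inj _≡_ (d₁ ∷ d₂ ∷ d₃ ∷ []) (dartsAt F v) ((d₁₂ ∷ d₁₃ ∷ []) ∷ (d₂₃ ∷ []) ∷ [] ∷ [])
        (λ { (here refl) → _ , ∈-dartsAt⁺ {F} f₁ t₁ , refl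
           ; (there (here refl)) → _ , ∈-dartsAt⁺ {F} f₂ t₂ , refl
           ; (there (there (here refl))) → _ , ∈-dartsAt⁺ {F} f₃ t₃ , refl })
        (λ _ _ p q → trans p (sym q))

  -- Colours and matchings of darts.

  module Coloured (A₁ A₂ : EdgeSet m) where

    A : Bool → EdgeSet m
    A true  = A₁
    A false = A₂

    kindOf : Fin m → Kind
    kindOf e = kind (A₁ e) (A₂ e)

    Sole : Bool → Fin m → Set
    Sole c e = kindOf e ≡ only c

    has⇒A : ∀ {c e} → Sole c e ⊎ kindOf e ≡ both → A c e ≡ true
    has⇒A {true}  {e} h with A₁ e | A₂ e
    ... | true  | _     = refl
    ... | false | true  = case h of λ { (inj₁ ()) ; (inj₂ ()) }
    ... | false | false = case h of λ { (inj₁ ()) ; (inj₂ ()) }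
    has⇒A {false} {e} h with A₁ e | A₂ e
    ... | _     | true  = refl
    ... | true  | false = case h of λ { (inj₁ ()) ; (inj₂ ()) }
    ... | false | false = case h of λ { (inj₁ ()) ; (inj₂ ()) }

    sole-out : ∀ {c d e} → Opp c d → Sole c e → A d e ≡ false
    sole-out {e = e} red-blue p with A₁ e | A₂ e | p
    ... | true  | false | _  = refl
    ... | true  | true  | ()
    ... | false | true  | ()
    sole-out {e = e} blue-red p with A₁ e | A₂ e | p
    ... | false | true  | _  = refl
    ... | true  | true  | ()
    ... | false | false | ()
    ... | true  | false | ()

    sole-△ : ∀ {c e} → Sole c e → (A₁ △ A₂) e ≡ true
    sole-△ {true}  p rewrite has⇒A {true} (inj₁ p)  | sole-out red-blue p = refl
    sole-△ {false} p rewrite has⇒A {false} (inj₁ p) | sole-out blue-red p = refl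

    △-sole : ∀ {e} → (A₁ △ A₂) e ≡ true → ∃ λ c → Sole c e
    △-sole {e} p with A₁ e | A₂ e
    ... | true  | false = true , refl
    ... | false | true  = false , refl

    sole-other : ∀ {c d e} → Opp c d → kindOf e ≢ none → A c e ≡ false → Sole d e
    sole-other {e = e} red-blue ¬none p with A₁ e | A₂ e
    ... | false | true  = refl
    ... | false | false = ⊥-elim (¬none refl)
    sole-other {e = e} blue-red ¬none p with A₁ e | A₂ e
    ... | true  | false = refl
    ... | false | false = ⊥-elim (¬none refl)

    sole⇒≢none : ∀ {c e} → Sole c e → kindOf e ≢ none
    sole⇒≢none p q with () ← trans (sym p) q

    A⇒≢none : ∀ {c e} → A c e ≡ true → kindOf e ≢ none
    A⇒≢none {true}  {e} p q with A₁ e | A₂ e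
    A⇒≢none {true}  p () | true | true
    A⇒≢none {true}  p () | true | false
    A⇒≢none {false} {e} p q with A₁ e | A₂ e
    A⇒≢none {false} p () | true  | true
    A⇒≢none {false} p () | false | true

    Opposite : Fin m → Fin m → Set
    Opposite e f = ∃₂ λ c d → Opp c d × Sole c e × Sole d f

    opposite-sole : ∀ {c d e f} → Opp c d → Sole c e → Opposite e f → Sole d f
    opposite-sole red-blue p (_ , _ , red-blue , _ , q) = q
    opposite-sole blue-red p (_ , _ , blue-red , _ , q) = q
    opposite-sole red-blue p (_ , _ , blue-red , p′ , _) with () ← trans (sym p) p′
    opposite-sole blue-red p (_ , _ , red-blue , p′ , _) with () ← trans (sym p) p′

    opposite-sym : ∀ {e f} → Opposite e f → Opposite f e
    opposite-sym (_ , _ , o , p , q) = _ , _ , Opp-sym o , q , p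

    opposite? : ∀ e f → Dec (Opposite e f)
    opposite? e f = map′
      (λ { (inj₁ (p , q)) → _ , _ , red-blue , p , q ; (inj₂ (p , q)) → _ , _ , blue-red , p , q })
      (λ { (_ , _ , red-blue , p , q) → inj₁ (p , q) ; (_ , _ , blue-red , p , q) → inj₂ (p , q) })
      (((kindOf e ≟ᵏ only true) ×-dec (kindOf f ≟ᵏ only false)) ⊎-dec ((kindOf e ≟ᵏ only false) ×-dec (kindOf f ≟ᵏ only true)))

    record Compatible (h k : Dart) : Set where
      constructor compatible
      field
        same-tail : tail h ≡ tail k
        opposite  : Opposite (edge h) (edge k)
    open Compatible

    compatible? : ∀ h k → Dec (Compatible h k)
    compatible? h k = map′ (λ (t , o) → compatible t o) (λ c → same-tail c , opposite c)
      ((tail h ≟ tail k) ×-dec opposite? (edge h) (edge k))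

    compatible-sym : ∀ {h k} → Compatible h k → Compatible k h
    compatible-sym (compatible t o) = compatible (sym t) (opposite-sym o)

    compatible-≢ : ∀ {h k} → Compatible h k → h ≢ k
    compatible-≢ (compatible _ (_ , _ , red-blue , p , q)) refl with () ← trans (sym p) q
    compatible-≢ (compatible _ (_ , _ , blue-red , p , q)) refl with () ← trans (sym p) q

    -- One partial involution on all darts stands for the matchings at all vertices, since
    -- compatible darts share their tail.
    record Matching : Set where
      field
        mate            : Dart → Maybe Dart
        mate-sym        : ∀ {h k} → mate h ≡ just k → mate k ≡ just h
        mate-compatible : ∀ {h k} → mate h ≡ just k → Compatible h k
    open Matching

    _⊑_ : Matching → Matching → Set
    M ⊑ N = ∀ {h k} → mate M h ≡ just k → mate N h ≡ just k

    empty : Matching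
    empty = record { mate = λ _ → nothing ; mate-sym = λ () ; mate-compatible = λ () }

    module _ (M : Matching) {h k : Dart} (h~k : Compatible h k) (h-free : mate M h ≡ nothing) (k-free : mate M k ≡ nothing) where

      mate⁺ : Dart → Maybe Dart
      mate⁺ d with d ≟ᵈ h | d ≟ᵈ k
      ... | yes _ | _     = just k
      ... | no _  | yes _ = just h
      ... | no _  | no _  = mate M d

      mate⁺-h : mate⁺ h ≡ just k
      mate⁺-h with h ≟ᵈ h | h ≟ᵈ k
      ... | yes _ | _ = refl
      ... | no ¬p | _ = ⊥-elim (¬p refl)

      mate⁺-k : mate⁺ k ≡ just h
      mate⁺-k with k ≟ᵈ h | k ≟ᵈ k
      ... | yes p | _     = ⊥-elim (compatible-≢ h~k (sym p))
      ... | no _  | yes _ = refl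
      ... | no _  | no ¬p = ⊥-elim (¬p refl)

      mate⁺-old : ∀ {d d′} → mate M d ≡ just d′ → mate⁺ d ≡ just d′
      mate⁺-old {d} e with d ≟ᵈ h | d ≟ᵈ k
      ... | yes refl | _        with () ← trans (sym h-free) e
      ... | no _     | yes refl with () ← trans (sym k-free) e
      ... | no _     | no _     = e

      mate⁺⁻ : ∀ {d d′} → mate⁺ d ≡ just d′ → (d ≡ h × d′ ≡ k) ⊎ (d ≡ k × d′ ≡ h) ⊎ mate M d ≡ just d′
      mate⁺⁻ {d} e with d ≟ᵈ h | d ≟ᵈ k
      ... | yes p | _     = inj₁ (p , sym (just-injective e))
      ... | no _  | yes p = inj₂ (inj₁ (p , sym (just-injective e)))
      ... | no _  | no _  = inj₂ (inj₂ e)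

      add : Matching
      add = record
        { mate            = mate⁺
        ; mate-sym        = λ {h} e → case mate⁺⁻ {h} e of λ
            { (inj₁ (refl , refl))        → mate⁺-k
            ; (inj₂ (inj₁ (refl , refl))) → mate⁺-h
            ; (inj₂ (inj₂ e′))            → mate⁺-old (mate-sym M e′) }
        ; mate-compatible = λ {h} e → case mate⁺⁻ {h} e of λ
            { (inj₁ (refl , refl))        → h~k
            ; (inj₂ (inj₁ (refl , refl))) → compatible-sym h~k
            ; (inj₂ (inj₂ e′))            → mate-compatible M e′ }
        }

    Saturated : Matching → Dart × Dart → Set
    Saturated M (h , k) = Compatible h k → mate M h ≢ nothing ⊎ mate M k ≢ nothing

    -- Compatible pairs that are still free are matched one after another. Mates are never given up,
    -- so a saturated pair stays saturated and the pairs prescribed in `M` survive.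
    greedy : ∀ M ps → ∃ λ N → M ⊑ N × All (Saturated N) ps
    greedy M [] = M , (λ e → e) , []
    greedy M ((h , k) ∷ ps)
      with mate M h in hm | mate M k in km | compatible? h k
    ... | nothing | nothing | yes h~k
      with N , M⊑N , sat ← greedy (add M h~k hm km) ps
      = N , (λ e → M⊑N (mate⁺-old M h~k hm km e))
          , (λ _ → inj₁ λ e → case trans (sym (M⊑N (mate⁺-h M h~k hm km))) e of λ ()) ∷ sat
    ... | nothing | nothing | no ¬h~k with N , M⊑N , sat ← greedy M ps = N , M⊑N , (⊥-elim ∘ ¬h~k) ∷ sat
    ... | just _ | _ | _ with N , M⊑N , sat ← greedy M ps =
      N , M⊑N , (λ _ → inj₁ λ e → case trans (sym (M⊑N hm)) e of λ ()) ∷ sat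
    ... | nothing | just _ | _ with N , M⊑N , sat ← greedy M ps =
      N , M⊑N , (λ _ → inj₂ λ e → case trans (sym (M⊑N km)) e of λ ()) ∷ sat

    allDarts : List Dart
    allDarts = cartesianProduct (allFin m) (true ∷ false ∷ [])

    ∈-allDarts : ∀ d → d ∈ allDarts
    ∈-allDarts (e , true)  = ∈-cartesianProduct⁺ (∈-allFin e) (here refl)
    ∈-allDarts (e , false) = ∈-cartesianProduct⁺ (∈-allFin e) (there (here refl))

    Maximal : Matching → Set
    Maximal M = ∀ {h k} → Compatible h k → mate M h ≢ nothing ⊎ mate M k ≢ nothing

    maximal : ∀ M → ∃ λ N → M ⊑ N × Maximal N
    maximal M with N , M⊑N , sat ← greedy M (cartesianProduct allDarts allDarts) =
      N , M⊑N , λ {h} {k} → All.lookup sat (∈-cartesianProduct⁺ (∈-allDarts h) (∈-allDarts k))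

    stOf : ∀ {u v} → Dec (∃ λ e → Joins G e u v) → Kind
    stOf (yes (e , _)) = kindOf e
    stOf (no _)        = none

    abstract
      st : Fin n → Fin n → Kind
      st u v = stOf (any? (joins? u v))

      st-joins : ∀ {e u v} → Joins G e u v → st u v ≡ kindOf e
      st-joins {e} {u} {v} j with any? (joins? u v)
      ... | yes (f , j′) = cong kindOf (joins-unique j′ j)
      ... | no ¬j        = ⊥-elim (¬j (e , j))

      st-edge : ∀ {u v} → st u v ≢ none → ∃ λ e → Joins G e u v
      st-edge {u} {v} e with any? (joins? u v)
      ... | yes p = p
      ... | no _  = ⊥-elim (e refl)

      st-sym : ∀ u v → st u v ≡ st v u
      st-sym u v with any? (joins? u v)
      ... | yes (e , j) = sym (st-joins (joins-sym j))
      ... | no ¬j with any? (joins? v u)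
      ...   | yes (e , j) = ⊥-elim (¬j (e , joins-sym j))
      ...   | no _        = refl

    arc : ∀ {u v} → st u v ≢ none → ∃ (Arc u v)
    arc e with f , j ← st-edge e with s , t , h ← joins⇒dart j = (f , s) , arrow t h

    arc-kind : ∀ {u v d} → Arc u v d → kindOf (edge d) ≡ st u v
    arc-kind a = sym (st-joins (arc-joins a))

    has⇒st≢none : ∀ {c u v} → st u v ≡ only c ⊎ st u v ≡ both → st u v ≢ none
    has⇒st≢none (inj₁ p) e with () ← trans (sym p) e
    has⇒st≢none (inj₂ p) e with () ← trans (sym p) e

    has-arc : ∀ {c u v} → st u v ≡ only c ⊎ st u v ≡ both → ∃ λ d → Arc u v d × A c (edge d) ≡ true
    has-arc h with d , a ← arc (has⇒st≢none h) =
      d , a , has⇒A ([ inj₁ ∘ trans (arc-kind a) , inj₂ ∘ trans (arc-kind a) ]′ h)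

    deg≤2 : (∀ c → IsTwoMatching G (A c)) → ∀ {c v a b d}
      → st v a ≡ only c ⊎ st v a ≡ both → st v b ≡ only c ⊎ st v b ≡ both → st v d ≡ only c ⊎ st v d ≡ both
      → a ≢ b → a ≢ d → b ≢ d → ⊥
    deg≤2 two {c} {v} ha hb hd a≢b a≢d b≢d
      with da , arrow ta ha′ , fa ← has-arc ha
      with db , arrow tb hb′ , fb ← has-arc hb
      with dd , arrow td hd′ , fd ← has-arc hd
      = no-three-darts {A c} {v} {da} {db} {dd} (two c v) fa fb fd ta tb td
          (λ { refl → a≢b (trans (sym ha′) hb′) }) (λ { refl → a≢d (trans (sym ha′) hd′) })
          (λ { refl → b≢d (trans (sym hb′) hd′) })

    -- Alternating trails and their merging.

    Joint : Dart → Dart → Set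
    Joint d d′ = Compatible (flip d) d′

    data Trail : Dart → Dart → List Dart → Set where
      single : ∀ {d c} → Sole c (edge d) → Trail d d (d ∷ [])
      _∷_    : ∀ {d d′ z ds} → Joint d d′ → Trail d′ z ds → Trail d z (d ∷ ds)

    joint-flip : ∀ {d d′} → Joint d d′ → Joint (flip d′) (flip d)
    joint-flip {d} {d′} j = subst (λ x → Compatible x (flip d)) (sym (flip-flip d′)) (compatible-sym j)

    append : ∀ {a z b y ds es} → Trail a z ds → Joint z b → Trail b y es → Trail a y (ds ++ es)
    append (single _) j u = j ∷ u
    append (i ∷ t)    j u = i ∷ append t j u

    backwards : ∀ {a z ds} → Trail a z ds → ∃ λ es → Trail (flip z) (flip a) es × map edge es ↭ map edge ds
    backwards (single p) = _ , single p , refl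
    backwards {a} (_∷_ {ds = ds} j t) with es , u , p ← backwards t =
      es ++ flip a ∷ [] ,
      append u (joint-flip j) (single (proj₁ (proj₂ (proj₂ (proj₂ (opposite j)))))) ,
      ↭trans (↭-reflexive (map-++ edge es (flip a ∷ []))) (↭trans (++-comm (map edge es) (edge a ∷ [])) (prep (edge a) p))

    record Path : Set where
      constructor path
      field
        {first last} : Dart
        {darts}      : List Dart
        trail        : Trail first last darts
    open Path

    edges : Path → List (Fin m)
    edges P = map edge (darts P)

    -- Both end darts point into the path, hence the `flip`: their tails are the vertices where the
    -- path can be continued.
    IsEnd : Path → Dart → Set
    IsEnd P h = h ≡ first P ⊎ h ≡ flip (last P)

    start∈edges : ∀ P → edge (first P) ∈ edges P
    start∈edges (path (single _)) = here refl
    start∈edges (path (_ ∷ _))    = here refl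

    last∈darts : ∀ {a z ds} → Trail a z ds → z ∈ ds
    last∈darts (single _) = here refl
    last∈darts (_ ∷ t)    = there (last∈darts t)

    end∈edges : ∀ {P h} → IsEnd P h → edge h ∈ edges P
    end∈edges {P} (inj₁ refl) = start∈edges P
    end∈edges {P} (inj₂ refl) = ∈-map⁺ edge (last∈darts (trail P))

    orient : ∀ P {h} → IsEnd P h
      → ∃ λ Q → first Q ≡ h × edges Q ↭ edges P × (∀ {g} → IsEnd P g → IsEnd Q g)
    orient P (inj₁ refl) = P , refl , refl , λ e → e
    orient P (inj₂ refl) with es , u , p ← backwards (trail P) =
      path u , refl , p , λ { (inj₁ refl) → inj₂ (sym (flip-flip _)) ; (inj₂ refl) → inj₁ refl }

    -- `P` is run backwards so that it stops at the tail of `h`, where `Q` takes over with `k`. Only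
    -- `h` and `k` cease to be ends.
    join : ∀ P Q {h k} → IsEnd P h → IsEnd Q k → Compatible h k
      → ∃ λ J → edges J ↭ edges P ++ edges Q
          × (∀ {g} → g ≢ h → IsEnd P g → IsEnd J g) × (∀ {g} → g ≢ k → IsEnd Q g → IsEnd J g)
    join P Q {h} {k} hP kQ h~k
      with P′ , refl , pP , endP ← orient P hP
      with Q′ , refl , pQ , endQ ← orient Q kQ
      with es , u , p ← backwards (trail P′)
      = path (append u (subst (λ x → Compatible x k) (sym (flip-flip h)) h~k) (trail Q′))
      , ↭trans (↭-reflexive (map-++ edge es (darts Q′))) (++⁺ (↭trans p pP) pQ)
      , (λ g≢h e → case endP e of λ { (inj₁ g≡h) → ⊥-elim (g≢h g≡h) ; (inj₂ g≡l) → inj₁ g≡l })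
      , (λ g≢k e → case endQ e of λ { (inj₁ g≡k) → ⊥-elim (g≢k g≡k) ; (inj₂ g≡l) → inj₂ g≡l })

    Together : List Path → Fin m → Fin m → Set
    Together 𝒫 e f = ∃ λ P → P ∈ 𝒫 × e ∈ edges P × f ∈ edges P

    End : List Path → Dart → Set
    End 𝒫 h = ∃ λ P → P ∈ 𝒫 × IsEnd P h

    together? : ∀ 𝒫 e f → Dec (Together 𝒫 e f)
    together? 𝒫 e f = map′ find (λ (_ , i , p) → lose i p) (Any.any? (λ P → (e ∈ᶠ? edges P) ×-dec (f ∈ᶠ? edges P)) 𝒫)
      where _∈ᶠ?_ = member? _≟_

    △-list : List (Fin m)
    △-list = filter (λ e → (A₁ △ A₂) e ≟ᵇ true) (allFin m)

    -- A permutation of a duplicate-free list: it makes the trails disjoint, free of repeated edges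
    -- and exhaustive at once.
    Decomposition : List Path → Set
    Decomposition 𝒫 = concatMap edges 𝒫 ↭ △-list

    module Merging (M : Matching) where

      Mergeable : List Path → Set
      Mergeable 𝒫 = ∀ {h k} → mate M h ≡ just k → Together 𝒫 (edge h) (edge k) ⊎ End 𝒫 h

      -- Both darts are ends by the invariant, and of different paths, for on one path they would
      -- already be together. Mates at the two ends of one path just close it up and call for no
      -- merging.
      merge : ∀ {𝒫 h k} → Decomposition 𝒫 → Mergeable 𝒫 → mate M h ≡ just k → ¬ Together 𝒫 (edge h) (edge k)
        → ∃ λ 𝒬 → Decomposition 𝒬 × Mergeable 𝒬 × Together 𝒬 (edge h) (edge k)
            × (∀ {e f} → Together 𝒫 e f → Together 𝒬 e f)
      merge {𝒫} {h} {k} dec mrg hk ¬tog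
        with mrg hk | mrg (mate-sym M hk)
      ... | inj₁ t | _ = ⊥-elim (¬tog t)
      ... | inj₂ _ | inj₁ (P , i , p , q) = ⊥-elim (¬tog (P , i , q , p))
      ... | inj₂ (P , P∈ , hP) | inj₂ (Q , Q∈ , kQ)
        with 𝒫₁ , p₁ ← extract P∈
        with ∈-resp-↭ p₁ Q∈
      ...   | here refl = ⊥-elim (¬tog (P , P∈ , end∈edges {P} hP , end∈edges {P} kQ))
      ...   | there Q∈′
        with ℛ , p₂ ← extract Q∈′
        with J , pJ , endP , endQ ← join P Q hP kQ (mate-compatible M hk)
        = J ∷ ℛ , dec′ , mrg′ , tog , mono
        where
          split : 𝒫 ↭ P ∷ Q ∷ ℛ
          split = ↭trans p₁ (prep P p₂)
          dec′ : Decomposition (J ∷ ℛ)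
          dec′ = ↭trans (++⁺ʳ (concatMap edges ℛ) pJ)
            (↭trans (↭-reflexive (++-assoc (edges P) (edges Q) _))
            (↭trans (↭-sym (concatMap-↭ edges split)) dec))
          inP : ∀ {e} → e ∈ edges P → e ∈ edges J
          inP i = ∈-resp-↭ (↭-sym pJ) (∈-++⁺ˡ i)
          inQ : ∀ {e} → e ∈ edges Q → e ∈ edges J
          inQ i = ∈-resp-↭ (↭-sym pJ) (∈-++⁺ʳ (edges P) i)
          tog : Together (J ∷ ℛ) (edge h) (edge k)
          tog = J , here refl , inP (end∈edges {P} hP) , inQ (end∈edges {Q} kQ)
          mono : ∀ {e f} → Together 𝒫 e f → Together (J ∷ ℛ) e f
          mono (R , R∈ , p , q) with ∈-resp-↭ split R∈
          ... | here refl         = J , here refl , inP p , inP q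
          ... | there (here refl) = J , here refl , inQ p , inQ q
          ... | there (there j)   = R , there j , p , q
          mrg′ : Mergeable (J ∷ ℛ)
          mrg′ {g} {g′} gg with mrg gg
          ... | inj₁ t = inj₁ (mono t)
          ... | inj₂ (R , R∈ , gR) with ∈-resp-↭ split R∈
          ...   | there (there j) = inj₂ (R , there j , gR)
          ...   | here refl with g ≟ᵈ h
          ...     | no g≢h = inj₂ (J , here refl , endP g≢h gR)
          -- The dart `h` may no longer be an end, but its only mate `k` now lies on the same path.
          ...     | yes refl with refl ← just-injective (trans (sym hk) gg) = inj₁ tog
          mrg′ {g} {g′} gg | inj₂ (R , R∈ , gR) | there (here refl) with g ≟ᵈ k
          ...     | no g≢k = inj₂ (J , here refl , endQ g≢k gR)
          ...     | yes refl with refl ← just-injective (trans (sym (mate-sym M hk)) gg)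
            = inj₁ (J , here refl , inQ (end∈edges {Q} kQ) , inP (end∈edges {P} hP))

      merge-all : ∀ hs {𝒫} → Decomposition 𝒫 → Mergeable 𝒫
        → ∃ λ 𝒬 → Decomposition 𝒬 × (∀ {e f} → Together 𝒫 e f → Together 𝒬 e f)
            × All (λ h → ∀ {k} → mate M h ≡ just k → Together 𝒬 (edge h) (edge k)) hs
      merge-all [] dec mrg = _ , dec , (λ t → t) , []
      merge-all (h ∷ hs) {𝒫} dec mrg with mate M h in hm
      ... | nothing with 𝒬 , dec′ , mono , tog ← merge-all hs dec mrg =
        𝒬 , dec′ , mono , (λ e → case trans (sym hm) e of λ ()) ∷ tog
      ... | just k with together? 𝒫 (edge h) (edge k)
      ...   | yes t with 𝒬 , dec′ , mono , tog ← merge-all hs dec mrg =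
        𝒬 , dec′ , mono , (λ e → subst (Together 𝒬 (edge h) ∘ edge) (just-injective (trans (sym hm) e)) (mono t)) ∷ tog
      ...   | no ¬t
        with ℛ , decR , mrgR , t , monoR ← merge dec mrg hm ¬t
        with 𝒬 , dec′ , mono , tog ← merge-all hs decR mrgR =
        𝒬 , dec′ , mono ∘ monoR , (λ e → subst (Together 𝒬 (edge h) ∘ edge) (just-injective (trans (sym hm) e)) (mono t)) ∷ tog

    singles : ∀ es → All (λ e → (A₁ △ A₂) e ≡ true) es
      → ∃ λ 𝒫 → concatMap edges 𝒫 ≡ es × (∀ {e} s → e ∈ es → End 𝒫 (e , s))
    singles []       []       = [] , refl , λ _ ()
    singles (e ∷ es) (p ∷ ps) with 𝒫 , eq , end ← singles es ps =
      path {d₀} {d₀} (single (proj₂ (△-sole p))) ∷ 𝒫 , cong (e ∷_) eq , λ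
        { false (here refl) → _ , here refl , inj₁ refl
        ; true  (here refl) → _ , here refl , inj₂ refl
        ; s     (there i)   → let P , j , q = end s i in P , there j , q }
      where
        d₀ : Dart
        d₀ = e , false

    ∈-△-list : ∀ {c e} → Sole c e → e ∈ △-list
    ∈-△-list {e = e} p = ∈-filter⁺ (λ e → (A₁ △ A₂) e ≟ᵇ true) (∈-allFin e) (sole-△ p)

    -- Merging starts with every edge as a path of its own, where both of its darts are ends.
    decompose : ∀ M → ∃ λ 𝒬 → Decomposition 𝒬 × (∀ {h k} → mate M h ≡ just k → Together 𝒬 (edge h) (edge k))
    decompose M
      with 𝒫 , eq , end ← singles △-list (AllP.all-filter (λ e → (A₁ △ A₂) e ≟ᵇ true) (allFin m))
      with 𝒬 , dec , _ , tog ← Merging.merge-all M allDarts {𝒫} (↭-reflexive eq)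
             (λ { {h} e → let (_ , _ , _ , p , _) = opposite (mate-compatible M e) in inj₂ (end (proj₂ h) (∈-△-list p)) })
      = 𝒬 , dec , λ {h} → All.lookup tog (∈-allDarts h)

    trail-walk : ∀ {a z ds} → Trail a z ds → WalkFrom G (tail a) (map edge ds)
    trail-walk (single {d} _) = cons (edge d) (joins d) (nil _)
    trail-walk (_∷_ {d} j t) = cons (edge d) (joins d)
      (subst (λ u → WalkFrom G u _) (sym (same-tail j)) (trail-walk t))

    OnlyIn-sole : ∀ {c d e} → Opp c d → Sole c e → OnlyIn (A c) (A d) e
    OnlyIn-sole o p = has⇒A (inj₁ p) , sole-out o p

    sole-onlyIn : ∀ {c e} → Sole c e → OnlyIn A₁ A₂ e ⊎ OnlyIn A₂ A₁ e
    sole-onlyIn {true}  p = inj₁ (OnlyIn-sole red-blue p)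
    sole-onlyIn {false} p = inj₂ (OnlyIn-sole blue-red p)

    opposite-onlyIn : ∀ {e f} → Opposite e f → (OnlyIn A₁ A₂ e × OnlyIn A₂ A₁ f) ⊎ (OnlyIn A₂ A₁ e × OnlyIn A₁ A₂ f)
    opposite-onlyIn (_ , _ , red-blue , p , q) = inj₁ (OnlyIn-sole red-blue p , OnlyIn-sole blue-red q)
    opposite-onlyIn (_ , _ , blue-red , p , q) = inj₂ (OnlyIn-sole blue-red p , OnlyIn-sole red-blue q)

    trail-alternating : ∀ {a z ds} → Trail a z ds → IsAlternating A₁ A₂ (map edge ds)
    trail-alternating (single p) = sole-onlyIn p ∷ [] , [-]
    trail-alternating (j ∷ t) with (_ , _ , _ , p , _) ← opposite j with trail-alternating t | t
    ... | all , linked | single _ = sole-onlyIn p ∷ all , opposite-onlyIn (opposite j) ∷ linked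
    ... | all , linked | _ ∷ _    = sole-onlyIn p ∷ all , opposite-onlyIn (opposite j) ∷ linked

    trail-nonempty : ∀ {a z ds} → Trail a z ds → map edge ds ≢ []
    trail-nonempty (single _) ()
    trail-nonempty (_ ∷ _)    ()

another : ∀ c → ∃ λ d → Opp c d
another true  = false , red-blue
another false = true , blue-red

opp-other : ∀ {c d k} → Opp k d → k ≢ c → d ≡ c
opp-other {true}  red-blue k≢c = ⊥-elim (k≢c refl)
opp-other {false} red-blue _   = refl
opp-other {true}  blue-red _   = refl
opp-other {false} blue-red k≢c = ⊥-elim (k≢c refl)

-- Realising the prescriptions in the graph.

module Main {n m : ℕ} (G : Graph n m) (A₁ A₂ : EdgeSet m) (two₁ : IsTwoMatching G A₁) (two₂ : IsTwoMatching G A₂) where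

  open Darts G
  open Coloured A₁ A₂
  open Matching
  open Compatible
  open Arc
  open Path

  two : ∀ c → IsTwoMatching G (A c)
  two true  = two₁
  two false = two₂

  module C = Prescriptions st st-sym (deg≤2 two)

  LinkIn : Matching → Fin n → Fin n → Fin n → Set
  LinkIn M v a b = ∃₂ λ h k → Arc v a h × Arc v b k × mate M h ≡ just k

  arc-compatible : ∀ {c d v a b h k} → Opp c d → C.Only c v a → C.Only d v b → Arc v a h → Arc v b k → Compatible h k
  arc-compatible o p q x y =
    compatible (trans (tail≡ x) (sym (tail≡ y))) (_ , _ , o , trans (arc-kind x) p , trans (arc-kind y) q)

  -- The first component keeps all darts at a new vertex unmatched, so that its prescribed pair can
  -- be added.
  Prescribed : List C.Prescription → Matching → Set
  Prescribed Δ M = (∀ {h k} → mate M h ≡ just k → tail h ∈ C.keys Δ) × All (λ (v , a , b) → LinkIn M v a b) Δ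

  prescribe-one : ∀ {v a b c d Δ h k} M → Prescribed Δ M → v ∉ C.keys Δ
    → Opp c d → C.Only c v a → C.Only d v b → Arc v a h → Arc v b k → ∃ (Prescribed ((v , a , b) ∷ Δ))
  prescribe-one {v} {Δ = Δ} {h} {k} M (within , links) v∉ o va vb ah ak =
    add M h~k hf kf , (λ {d} → within′ {d}) , (h , k , ah , ak , mate⁺-h M h~k hf kf)
      ∷ All.map (λ (h′ , k′ , x , y , e) → h′ , k′ , x , y , mate⁺-old M h~k hf kf e) links
    where
      h~k : Compatible h k
      h~k = arc-compatible o va vb ah ak
      free : ∀ {w d} → Arc v w d → mate M d ≡ nothing
      free {d = d} x with mate M d in eq
      ... | nothing = refl
      ... | just _  = ⊥-elim (v∉ (subst (_∈ C.keys Δ) (tail≡ x) (within eq)))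
      hf : mate M h ≡ nothing
      hf = free ah
      kf : mate M k ≡ nothing
      kf = free ak
      within′ : ∀ {d d′} → mate⁺ M h~k hf kf d ≡ just d′ → tail d ∈ v ∷ C.keys Δ
      within′ {d} e with mate⁺⁻ M h~k hf kf {d} e
      ... | inj₁ (refl , _)        = here (tail≡ ah)
      ... | inj₂ (inj₁ (refl , _)) = here (tail≡ ak)
      ... | inj₂ (inj₂ e′)         = there (within e′)

  prescribe : ∀ Δ → All C.Valid Δ → Unique (C.keys Δ) → ∃ (Prescribed Δ)
  prescribe [] _ _ = empty , (λ ()) , []
  prescribe ((v , a , b) ∷ Δ) ((_ , _ , o , _ , _ , va , vb) ∷ val) (v∉ ∷ uni) =
    prescribe-one (proj₁ rest) (proj₂ rest) (λ i → All.lookup v∉ i refl) o va vb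
      (proj₂ (arc (C.Only⇒Adj va))) (proj₂ (arc (C.Only⇒Adj vb)))
    where
      rest : ∃ (Prescribed Δ)
      rest = prescribe Δ val uni

  -- For the colour `l` opposite to `k`, some edge of the triangle lies outside `A l`; being
  -- present, it has colour `k` only.
  mixed-kinds : ∀ {e₁ e₂ e₃ x y z} → Joins G e₁ x y → Joins G e₂ y z → Joins G e₃ z x
    → kindOf e₁ ≢ none → kindOf e₂ ≢ none → kindOf e₃ ≢ none
    → (∀ c → ¬ (A c e₁ ≡ true × A c e₂ ≡ true × A c e₃ ≡ true))
    → ∀ k → C.Only k x y ⊎ C.Only k y z ⊎ C.Only k x z
  mixed-kinds {e₁} {e₂} {e₃} j₁ j₂ j₃ n₁ n₂ n₃ ¬all k with l , o ← another k
    with A l e₁ in p₁ | A l e₂ in p₂ | A l e₃ in p₃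
  ... | false | _     | _     = inj₁ (trans (st-joins j₁) (sole-other (Opp-sym o) n₁ p₁))
  ... | true  | false | _     = inj₂ (inj₁ (trans (st-joins j₂) (sole-other (Opp-sym o) n₂ p₂)))
  ... | true  | true  | false = inj₂ (inj₂ (trans (st-joins (joins-sym j₃)) (sole-other (Opp-sym o) n₃ p₃)))
  ... | true  | true  | true  = ⊥-elim (¬all l (p₁ , p₂ , p₃))

  -- Trails of a maximal matching.

  module Decomposed (M : Matching) (M-maximal : Maximal M) (𝒬 : List Path) (𝒬-decomposition : Decomposition 𝒬)
    (mates-together : ∀ {h k} → mate M h ≡ just k → Together 𝒬 (edge h) (edge k)) where

    𝒫 : List (List (Fin m))
    𝒫 = map edges 𝒬

    𝒫-unique : Unique (concat 𝒫)
    𝒫-unique = Unique-resp-↭ (setoid (Fin m)) (↭⇒↭ₛ (↭-sym 𝒬-decomposition)) (Unique.filter⁺ (λ e → (A₁ △ A₂) e ≟ᵇ true) (Unique.allFin⁺ m))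

    𝒫-△ : ∀ e → e ∈ concat 𝒫 → (A₁ △ A₂) e ≡ true
    𝒫-△ e i = proj₂ (∈-filter⁻ (λ e → (A₁ △ A₂) e ≟ᵇ true) {xs = allFin m} (∈-resp-↭ 𝒬-decomposition i))

    △-𝒫 : ∀ e → (A₁ △ A₂) e ≡ true → e ∈ concat 𝒫
    △-𝒫 e p = ∈-resp-↭ (↭-sym 𝒬-decomposition) (∈-△-list (proj₂ (△-sole p)))

    -- Equal membership in all trails is an equivalence relation outright, and it is the form in
    -- which `A c △ toSet P` uses it.
    SameTrail : Fin m → Fin m → Set
    SameTrail e f = ∀ {P} → P ∈ 𝒫 → toSet P e ≡ toSet P f

    mates-same-trail : ∀ {h k} → mate M h ≡ just k → SameTrail (edge h) (edge k)
    mates-same-trail {h} {k} hk {P} P∈ with Q , Q∈ , h∈ , k∈ ← mates-together hk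
      with toSet P (edge h) in p | toSet P (edge k) in q
    ... | true  | true  = refl
    ... | false | false = refl
    ... | true  | false with refl ← same-member 𝒫-unique P∈ (∈-map⁺ edges Q∈) (toSet⁻ P p) h∈
                        with () ← trans (sym q) (toSet⁺ k∈)
    ... | false | true  with refl ← same-member 𝒫-unique P∈ (∈-map⁺ edges Q∈) (toSet⁻ P q) k∈
                        with () ← trans (sym p) (toSet⁺ h∈)

    -- A second mate b′ at v cannot be a loop: with the dart to b it would give v three darts of one colour.
    other-mate : ∀ {c d v a b h k k′} → Opp c d → b ≢ v → Arc v a h → Arc v b k
      → C.Only c v a → C.Only d v b → mate M h ≡ just k′ → k′ ≢ k
      → ∃ λ b′ → b′ ≢ b × b′ ≢ v × C.Only d v b′ × LinkIn M v a b′
    other-mate {c} {d} {v} {a} {b} {h} {k} {k′} o b≢v x y va vb hk′ k′≢k =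
      head k′ , b′≢b , b′≢v , trans (sym (arc-kind z)) k′-sole , h , k′ , x , z , hk′
      where
        compat : Compatible h k′
        compat = mate-compatible M hk′
        z : Arc v (head k′) k′
        z = arrow (trans (sym (same-tail compat)) (tail≡ x)) refl
        k′-sole : Sole d (edge k′)
        k′-sole = opposite-sole o (trans (arc-kind x) va) (opposite compat)
        b′≢b : head k′ ≢ b
        b′≢b e = k′≢k (arc-unique (≢-sym b≢v) (arrow (tail≡ z) e) y)
        b′≢v : head k′ ≢ v
        b′≢v e = no-three-darts {A d} {v} {k} {k′} {flip k′} (two d v)
          (has⇒A (inj₁ (trans (arc-kind y) vb))) (has⇒A (inj₁ k′-sole)) (has⇒A (inj₁ k′-sole))
          (tail≡ y) (tail≡ z) e (≢-sym k′≢k)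
          (λ k≡ → b≢v (trans (sym (head≡ y)) (trans (cong head k≡) (trans (cong tail (flip-flip k′)) (tail≡ z)))))
          (λ k′≡ → not-¬ refl (cong proj₂ k′≡))

    pairing : C.Pairing
    pairing = record
      { Link      = LinkIn M
      ; _≈_       = λ (u , v) (u′ , v′) → ∃₂ λ e f → Joins G e u v × Joins G f u′ v′ × SameTrail e f
      ; link-sym  = link-sym
      ; link-uniq = λ { a≢v (h , k , x , y , e) (h′ , k′ , x′ , y′ , e′) → link-uniq a≢v x x′ y y′ e e′ }
      ; link-max  = link-max
      ; link⇒≈    = λ (h , k , x , y , e) → edge h , edge k , arc-joins x , arc-joins y , mates-same-trail e
      ; ≈-sym     = λ (e , f , p , q , s) → f , e , q , p , λ i → sym (s i)
      ; ≈-trans   = λ (e , f , p , q , s) (f′ , g , q′ , r , s′) → e , g , p , r ,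
                      λ {P} i → trans (s i) (trans (cong (toSet P) (joins-unique q q′)) (s′ i))
      ; ≈-flip    = λ (e , f , p , q , s) → e , f , joins-sym p , q , s
      }
      where
        link-sym : ∀ {v a b} → LinkIn M v a b → LinkIn M v b a
        link-sym (h , k , x , y , e) = k , h , y , x , mate-sym M e

        link-uniq : ∀ {v a b b′ h k h′ k′} → a ≢ v → Arc v a h → Arc v a h′ → Arc v b k → Arc v b′ k′
          → mate M h ≡ just k → mate M h′ ≡ just k′ → b ≡ b′
        link-uniq a≢v x x′ y y′ e e′
          with refl ← arc-unique (≢-sym a≢v) x x′
          with refl ← just-injective (trans (sym e) e′)
          = trans (sym (head≡ y)) (head≡ y′)

        Max : Bool → Bool → Fin n → Fin n → Fin n → Set
        Max c d v a b = LinkIn M v a b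
          ⊎ (∃ λ b′ → b′ ≢ b × b′ ≢ v × C.Only d v b′ × LinkIn M v a b′)
          ⊎ (∃ λ a′ → a′ ≢ a × a′ ≢ v × C.Only c v a′ × LinkIn M v a′ b)

        -- By maximality one of `h` and `k` has a mate: it is either the other dart, or a dart
        -- described by `other-mate`.
        link-max-arcs : ∀ {c d v a b h k} → Opp c d → a ≢ v → b ≢ v → C.Only c v a → C.Only d v b
          → Arc v a h → Arc v b k → Max c d v a b
        link-max-arcs {h = h} {k} o a≢v b≢v va vb x y with mate M h in hm | mate M k in km
        ... | nothing | nothing = ⊥-elim ([ (λ ¬free → ¬free hm) , (λ ¬free → ¬free km) ]′
                                    (M-maximal (arc-compatible o va vb x y)))
        ... | just k′ | _ with k′ ≟ᵈ k
        ...   | yes refl = inj₁ (h , k , x , y , hm)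
        ...   | no k′≢k  = inj₂ (inj₁ (other-mate o b≢v x y va vb hm k′≢k))
        link-max-arcs {h = h} {k} o a≢v b≢v va vb x y | nothing | just h′ with h′ ≟ᵈ h
        ...   | yes refl with () ← trans (sym hm) (mate-sym M km)
        ...   | no h′≢h with a′ , p , q , r , l ← other-mate (Opp-sym o) a≢v y x vb va km h′≢h =
          inj₂ (inj₂ (a′ , p , q , r , link-sym l))

        link-max : ∀ {c d v a b} → Opp c d → a ≢ v → b ≢ v → C.Only c v a → C.Only d v b → Max c d v a b
        link-max o a≢v b≢v va vb =
          link-max-arcs o a≢v b≢v va vb (proj₂ (arc (C.Only⇒Adj va))) (proj₂ (arc (C.Only⇒Adj vb)))

    ∈𝒫-sole : ∀ {P e} → P ∈ 𝒫 → toSet P e ≡ true → ∃ λ c → Sole c e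
    ∈𝒫-sole {P} P∈ t = △-sole (𝒫-△ _ (∈-concat⁺′ (toSet⁻ P t) P∈))

    △-cases : ∀ c P {e} → (A c △ toSet P) e ≡ true
      → (A c e ≡ true × toSet P e ≡ false) ⊎ (A c e ≡ false × toSet P e ≡ true)
    △-cases c P {e} t with A c e | toSet P e
    ... | true  | false = inj₁ (refl , refl)
    ... | false | true  = inj₂ (refl , refl)

    △-present : ∀ c {P} → P ∈ 𝒫 → ∀ {e} → (A c △ toSet P) e ≡ true → kindOf e ≢ none
    △-present c {P} P∈ Fe with △-cases c P Fe
    ... | inj₁ (p , _) = A⇒≢none p
    ... | inj₂ (_ , q) = sole⇒≢none (proj₂ (∈𝒫-sole P∈ q))

    -- If every dart of colour `d` at `v` is matched, darts of `A c` are sent to themselves and the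
    -- darts that `P` adds to their mates, which have colour `c`. This is injective into `A c`:
    -- mates share a trail, so `P` removes the mate of every dart it adds.
    two-matching : ∀ c {P} → P ∈ 𝒫 → IsTwoMatching G (A c △ toSet P)
    two-matching c {P} P∈ v with d , o ← another c
      with Any.any? (λ j → (tail j ≟ v) ×-dec (kindOf (edge j) ≟ᵏ only d) ×-dec (Maybe.≡-dec _≟ᵈ_ (mate M j) nothing)) allDarts
    ... | no ¬free = ≤-trans (deg-inj F (A c) v R img inj) (two c v)
      where
        F : EdgeSet m
        F = A c △ toSet P
        R : Dart → Dart → Set
        R h g = (A c (edge h) ≡ true × g ≡ h) ⊎ (A c (edge h) ≡ false × mate M h ≡ just g)
        img : ∀ {h} → F (edge h) ≡ true → tail h ≡ v → ∃ λ g → A c (edge g) ≡ true × tail g ≡ v × R h g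
        img {h} Fh t with △-cases c P Fh
        ... | inj₁ (p , _) = h , p , t , inj₁ (p , refl)
        ... | inj₂ (p , q) with mate M h in hm
        ...   | nothing = ⊥-elim (¬free (lose (∈-allDarts h) (t , sole-other o (sole⇒≢none (proj₂ (∈𝒫-sole P∈ q))) p , hm)))
        ...   | just g  = g
                , has⇒A (inj₁ (opposite-sole (Opp-sym o) (sole-other o (sole⇒≢none (proj₂ (∈𝒫-sole P∈ q))) p) (opposite (mate-compatible M hm))))
                , trans (sym (same-tail (mate-compatible M hm))) t , inj₂ (p , refl)
        clash : ∀ {h h′} → F (edge h) ≡ true → F (edge h′) ≡ true
          → A c (edge h) ≡ true → A c (edge h′) ≡ false → mate M h′ ≡ just h → ⊥
        clash Fh Fh′ p p′ e with △-cases c P Fh | △-cases c P Fh′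
        ... | inj₂ (q , _) | _ with () ← trans (sym p) q
        ... | inj₁ _ | inj₁ (q , _) with () ← trans (sym p′) q
        ... | inj₁ (_ , q) | inj₂ (_ , q′) with () ← trans (sym q) (trans (sym (mates-same-trail e P∈)) q′)
        inj : ∀ {h h′ g} → F (edge h) ≡ true → F (edge h′) ≡ true → R h g → R h′ g → h ≡ h′
        inj _ _ (inj₁ (_ , refl)) (inj₁ (_ , refl)) = refl
        inj _ _ (inj₂ (_ , e)) (inj₂ (_ , e′)) = just-injective (trans (sym (mate-sym M e)) (mate-sym M e′))
        inj Fh Fh′ (inj₁ (p , refl)) (inj₂ (p′ , e)) = ⊥-elim (clash Fh Fh′ p p′ e)
        inj Fh Fh′ (inj₂ (p′ , e)) (inj₁ (p , refl)) = ⊥-elim (clash Fh′ Fh p p′ e)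
    -- The unmatched dart `j` has colour `d`, so by maximality every dart of colour `c` at `v` is
    -- matched. Sending the remaining ones of these to their mates now gives an injection into
    -- `A d`.
    ... | yes free with j , _ , tj , oj , jm ← find free = ≤-trans (deg-inj F (A d) v R img inj) (two d v)
      where
        F : EdgeSet m
        F = A c △ toSet P
        R : Dart → Dart → Set
        R h g = (A d (edge h) ≡ true × g ≡ h) ⊎ (Sole c (edge h) × mate M h ≡ just g)
        img : ∀ {h} → F (edge h) ≡ true → tail h ≡ v → ∃ λ g → A d (edge g) ≡ true × tail g ≡ v × R h g
        img {h} Fh t with A d (edge h) in p
        ... | true  = h , p , t , inj₁ (refl , refl)
        ... | false with h-sole ← sole-other {e = edge h} (Opp-sym o) (△-present c P∈ Fh) p
                    with mate M h in hm | M-maximal (compatible (trans t (sym tj)) (c , d , o , h-sole , oj))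
        ...   | nothing | inj₁ ¬free = ⊥-elim (¬free hm)
        ...   | nothing | inj₂ ¬free = ⊥-elim (¬free jm)
        ...   | just g  | _ = g , has⇒A (inj₁ (opposite-sole o h-sole (opposite (mate-compatible M hm))))
                , trans (sym (same-tail (mate-compatible M hm))) t , inj₂ (h-sole , refl)
        clash : ∀ {h h′} → F (edge h) ≡ true → F (edge h′) ≡ true
          → Sole c (edge h′) → mate M h′ ≡ just h → ⊥
        clash Fh Fh′ p′ e with h-sole ← opposite-sole o p′ (opposite (mate-compatible M e))
          with △-cases c P Fh | △-cases c P Fh′
        ... | inj₁ (q , _) | _ with () ← trans (sym q) (sole-out (Opp-sym o) h-sole)
        ... | inj₂ _ | inj₂ (q , _) with () ← trans (sym q) (has⇒A {c} (inj₁ p′))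
        ... | inj₂ (_ , q) | inj₁ (_ , q′) with () ← trans (sym q′) (trans (mates-same-trail e P∈) q)
        inj : ∀ {h h′ g} → F (edge h) ≡ true → F (edge h′) ≡ true → R h g → R h′ g → h ≡ h′
        inj _ _ (inj₁ (_ , refl)) (inj₁ (_ , refl)) = refl
        inj _ _ (inj₂ (_ , e)) (inj₂ (_ , e′)) = just-injective (trans (sym (mate-sym M e)) (mate-sym M e′))
        inj Fh Fh′ (inj₁ (p , refl)) (inj₂ (p′ , e)) = ⊥-elim (clash Fh Fh′ p′ e)
        inj Fh Fh′ (inj₂ (p′ , e)) (inj₁ (p , refl)) = ⊥-elim (clash Fh′ Fh p′ e)

    -- In `A c △ toSet P` an edge of colour `c` survives only outside `P`, and one of colour `d`
    -- appears only inside `P`.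
    clash : ∀ {c d P e f} → P ∈ 𝒫 → Opp c d → Sole c e → Sole d f
      → (A c △ toSet P) e ≡ true → (A c △ toSet P) f ≡ true → SameTrail e f → ⊥
    clash {c} {P = P} P∈ o p q Fe Ff s with △-cases c P Fe | △-cases c P Ff
    ... | inj₂ (r , _) | _ with () ← trans (sym r) (has⇒A (inj₁ p))
    ... | inj₁ _ | inj₁ (r , _) with () ← trans (sym r) (sole-out (Opp-sym o) q)
    ... | inj₁ (_ , r) | inj₂ (_ , r′) with () ← trans (sym r) (trans (s P∈) r′)

    opposite-clash : ∀ c {P k l e f} → P ∈ 𝒫 → Opp k l → Sole k e → Sole l f
      → (A c △ toSet P) e ≡ true → (A c △ toSet P) f ≡ true → SameTrail e f → ⊥
    opposite-clash c {k = k} P∈ o p q Fe Ff s with k ≟ᵇ c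
    ... | yes refl = clash P∈ o p q Fe Ff s
    ... | no k≢c with refl ← opp-other o k≢c = clash P∈ (Opp-sym o) q p Ff Fe λ i → sym (s i)

    satAt-clash : ∀ c {P u v w e f} → P ∈ 𝒫 → Joins G e u v → Joins G f u w
      → (A c △ toSet P) e ≡ true → (A c △ toSet P) f ≡ true → C.SatAt pairing u v w → ⊥
    satAt-clash c P∈ j j′ Fe Ff (_ , _ , o , p , q , (_ , _ , i , i′ , s)) =
      opposite-clash c P∈ o (trans (sym (st-joins j)) p) (trans (sym (st-joins j′)) q) Fe Ff λ {Q} Q∈ →
        trans (cong (toSet Q) (joins-unique j i)) (trans (s Q∈) (cong (toSet Q) (joins-unique i′ j′)))

    -- A forbidden triangle in `A c △ toSet P` lies in the union but in neither `T`-free set, so it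
    -- is mixed and hence satisfied. Its two edges of opposite colour on one trail contradict
    -- `clash`.
    triangle-free : ∀ {𝒯} → (∀ T → 𝒯 T → IsTriangle G T) → (∀ c → TFree 𝒯 (A c))
      → (∀ {a b c} → C.Tri a b c → C.Sat pairing a b c)
      → ∀ c {P} → P ∈ 𝒫 → TFree 𝒯 (A c △ toSet P)
    triangle-free {𝒯} 𝒯-tri free mixed-sat c {P} P∈ T T∈ T⊆ = go (𝒯-tri T T∈)
      where
        go : IsTriangle G T → ⊥
        go (e₁ , e₂ , e₃ , x , y , z , (x≢y , y≢z , x≢z) , j₁ , j₂ , j₃ , T⇔) =
          [ satAt-clash c P∈ j₁ (joins-sym j₃) F₁ F₃
          , [ satAt-clash c P∈ j₂ (joins-sym j₁) F₂ F₁ , satAt-clash c P∈ j₃ (joins-sym j₂) F₃ F₂ ]′ ]′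
            (mixed-sat (C.tri x≢y y≢z x≢z (adj j₁ F₁) (adj j₂ F₂) (adj (joins-sym j₃) F₃)
              (mixed-kinds j₁ j₂ j₃ (△-present c P∈ F₁) (△-present c P∈ F₂) (△-present c P∈ F₃)
                λ l (p₁ , p₂ , p₃) → free l T T∈ λ e t →
                  [ (λ { refl → p₁ }) , [ (λ { refl → p₂ }) , (λ { refl → p₃ }) ]′ ]′ (Equivalence.to (T⇔ e) t))))
          where
            F₁ : (A c △ toSet P) e₁ ≡ true
            F₁ = T⊆ e₁ (Equivalence.from (T⇔ e₁) (inj₁ refl))
            F₂ : (A c △ toSet P) e₂ ≡ true
            F₂ = T⊆ e₂ (Equivalence.from (T⇔ e₂) (inj₂ (inj₁ refl)))
            F₃ : (A c △ toSet P) e₃ ≡ true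
            F₃ = T⊆ e₃ (Equivalence.from (T⇔ e₃) (inj₂ (inj₂ refl)))
            adj : ∀ {e u v} → Joins G e u v → (A c △ toSet P) e ≡ true → C.Adj u v
            adj j Fe = △-present c P∈ Fe ∘ trans (sym (st-joins j))

    partition : IsAltTrailPartition G A₁ A₂ (A₁ △ A₂) 𝒫
    partition =
        AllP.map⁺ (All.tabulate λ {Q} Q∈ →
          (trail-nonempty (trail Q) , unique-member 𝒫-unique (∈-map⁺ edges Q∈) , _ , trail-walk (trail Q))
          , trail-alternating (trail Q))
      , 𝒫-unique , 𝒫-△ , △-𝒫

  Decomposable : (EdgeSet m → Set) → Set
  Decomposable 𝒯 = ∃ λ 𝒫 → IsAltTrailPartition G A₁ A₂ (A₁ △ A₂) 𝒫
    × (∀ c {P} → P ∈ 𝒫 → IsTwoMatching G (A c △ toSet P) × TFree 𝒯 (A c △ toSet P))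

  module _ {𝒯 : EdgeSet m → Set} (𝒯-tri : ∀ T → 𝒯 T → IsTriangle G T) (free : ∀ c → TFree 𝒯 (A c)) (S : C.Solution) where
    open C.Solution S

    from-trails : ∀ M → Maximal M → All (λ (v , a , b) → LinkIn M v a b) links
      → (∃ λ 𝒬 → Decomposition 𝒬 × (∀ {h k} → mate M h ≡ just k → Together 𝒬 (edge h) (edge k)))
      → Decomposable 𝒯
    from-trails M max holds (𝒬 , dec , tog) = D.𝒫 , D.partition , λ c P∈ →
      D.two-matching c P∈ , D.triangle-free 𝒯-tri free (sat D.pairing holds) c P∈
      where module D = Decomposed M max 𝒬 dec tog

    from-maximal : ∀ M₀ → Prescribed links M₀ → (∃ λ M → M₀ ⊑ M × Maximal M) → Decomposable 𝒯
    from-maximal M₀ (_ , holds) (M , M₀⊑M , max) = from-trails M max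
      (All.map (λ (h , k , x , y , e) → h , k , x , y , M₀⊑M e) holds) (decompose M)

    from-solution : Decomposable 𝒯
    from-solution = from-prescribed (prescribe links valid unique)
      where
        from-prescribed : ∃ (Prescribed links) → Decomposable 𝒯
        from-prescribed (M₀ , pr) = from-maximal M₀ pr (maximal M₀)

theorem2 : ∀ {n m} (G : Graph n m) (𝒯 : EdgeSet m → Set)
    → (∀ T → 𝒯 T → IsTriangle G T)
    → (A₁ A₂ : EdgeSet m)
    → IsTwoMatching G A₁ → TFree 𝒯 A₁
    → IsTwoMatching G A₂ → TFree 𝒯 A₂
    → Σ (List (List (Fin m))) λ 𝒫 →
    IsAltTrailPartition G A₁ A₂ (A₁ △ A₂) 𝒫
    × All (λ P → (IsTwoMatching G (A₁ △ toSet P) × TFree 𝒯 (A₁ △ toSet P))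
    × (IsTwoMatching G (A₂ △ toSet P) × TFree 𝒯 (A₂ △ toSet P))) 𝒫
theorem2 G 𝒯 𝒯-tri A₁ A₂ two₁ free₁ two₂ free₂ =
  conclude (from-solution 𝒯-tri (λ { true → free₁ ; false → free₂ }) C.solution)
  where
    open Main G A₁ A₂ two₁ two₂
    conclude : Decomposable 𝒯 → _
    conclude (𝒫 , partition , good) = 𝒫 , partition , All.tabulate λ P∈ → good true P∈ , good false P∈
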